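{- Let $G$ be a finite noncyclic group (not necessarily abelian) of order $n$, and let $p$ be the smallest prime divisor of $n$. Then $$\mathsf d(G) \le \frac{n}{p} + 9p^2 - 10p.$$
   Context: Groups are written multiplicatively with identity $1$. A sequence over $G$ is a finite unordered list of elements of $G$ with repetitions allowed (an element of the free abelian monoid on $G$); its length is the number of terms counted with multiplicity. A sequence $S = g_1 \cdots g_\ell$ is one-product free if there is no nonempty subsequence $g_{i_1}, \dots, g_{i_k}$ ($k\ge 1$, distinct indices) and ordering of it whose product equals $1$. The small Davenport constant $\mathsf d(G)$ is the maximal integer $\ell$ such that there exists a one-product free sequence over $G$ of length $\ell$. -}

module Defs where

open import Data.Nat using (ℕ; zero; suc)
open import Data.Fin using (Fin)
open import Data.List using (List; []; _∷_; foldr; length)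
open import Data.List.Relation.Binary.Sublist.Propositional using (_⊆_)
open import Data.List.Relation.Binary.Permutation.Propositional using (_↭_)
open import Data.Product using (Σ; ∃; _×_)
open import Relation.Nullary using (¬_)
open import Relation.Binary.PropositionalEquality using (_≡_)
open import Algebra.Structures using (IsGroup)

-- A finite group of order n: a group structure on the n-element set Fin n
-- (every finite group of order n is isomorphic to one of these).
record FiniteGroup (n : ℕ) : Set where
  field
    _∙_     : Fin n → Fin n → Fin n
    ε       : Fin n
    _⁻¹     : Fin n → Fin n
    isGroup : IsGroup _≡_ _∙_ ε _⁻¹

module _ {n : ℕ} (G : FiniteGroup n) where
  open FiniteGroup G

  pow : Fin n → ℕ → Fin n
  pow g zero    = ε
  pow g (suc k) = g ∙ pow g k

  Cyclic : Set
  Cyclic = ∃ λ (g : Fin n) → ∀ (h : Fin n) → ∃ λ (k : ℕ) → pow g k ≡ h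

  prod : List (Fin n) → Fin n
  prod = foldr _∙_ ε

  NonEmpty : List (Fin n) → Set
  NonEmpty []      = Data.Empty.⊥
    where import Data.Empty
  NonEmpty (_ ∷ _) = Data.Unit.⊤
    where import Data.Unit

  -- A sequence (finite unordered list, represented by a list) is one-product free
  -- if no nonempty subsequence, in any ordering, has product 1.
  OneProductFree : List (Fin n) → Set
  OneProductFree S = ∀ (T U : List (Fin n)) → T ⊆ S → U ↭ T → NonEmpty U → ¬ (prod U ≡ ε)

  IsSmallDavenport : ℕ → Set
  IsSmallDavenport d =
    (∃ λ (S : List (Fin n)) → OneProductFree S × length S ≡ d)
    × (∀ (S : List (Fin n)) → OneProductFree S → length S Data.Nat.≤ d)

{-# OPTIONS --safe #-}
-- Write p = m + 1, encode sequences by multiplicities, and let Π μ be the set of products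
-- of subsequences of μ, including the empty one. Kemperman's theorem makes |Π μ| − 1
-- superadditive on a one-product free sequence σ, so |σ| is bounded once p |μ| is at most
-- |Π μ| up to a few terms.
--
-- A term g enlarges B = Π μ by at least λ_B(g) = |Bg ∖ B|, and λ_B is subadditive in g.
-- Averaging λ_B over short products shows that a sequence with multiplicities ≤ 2m and
-- more than (9m + 6)m terms contains a nonempty V with |Π V| > p |V|. Split off such V as
-- long as possible, and then single terms that enlarge B by at least p. If a term r has
-- multiplicity ≥ p in the rest R, then any term y ∉ ⟨r⟩ of R leaves the p distinct cosets
-- yⁱ⟨r⟩ (i < p) partially filled by B, so r would enlarge B by p; hence R ⊆ ⟨r⟩. Terms
-- outside ⟨r⟩ set aside at the start then spread Π R over p cosets of ⟨r⟩.
module Submission where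

open import Defs
open import Data.Nat using (ℕ; _+_; _*_; _∸_; _≤_)
open import Data.Nat.Divisibility using (_∣_)
open import Data.Nat.Primality using (Prime)
open import Relation.Nullary using (¬_)

open import Algebra.Bundles using (Group)
open import Algebra.Structures using (IsGroup)
import Algebra.Properties.Group as GroupProperties
open import Data.Empty using (⊥-elim; ⊥)
open import Data.Fin using (Fin; zero; suc; toℕ; fromℕ<)
open import Data.Fin.Permutation using (permutation)
open import Data.Fin.Properties
  using (any?; pigeonhole; nonZeroIndex; toℕ<n; toℕ-fromℕ<; toℕ-injective) renaming (_≟_ to _≟ᶠ_)
open import Data.List using (List; []; _∷_; _++_; length)
open import Data.List.Relation.Binary.Permutation.Propositional using (_↭_; ↭-refl; ↭-trans; prep; swap)
open import Data.List.Relation.Binary.Sublist.Propositional using (_⊆_; []; _∷ʳ_; _∷_)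
open import Data.List.Relation.Unary.All using (_∷_)
open import Data.Nat
  using (zero; suc; _⊓_; _<_; z≤n; s≤s; _≤?_; _<?_; NonZero; >-nonZero; nonTrivial⇒n>1)
open import Data.Nat.Coprimality using (Coprime; coprime-Bézout)
open import Data.Nat.Divisibility
  using (divides; ∣-trans; ∣m∣n⇒∣m+n; ∣⇒≤; 0∣⇒≡0; n∣n; _∣0; m∣m*n)
open import Data.Nat.DivMod using (_/_; _%_; m≡m%n+[m/n]*n; m%n<n)
open import Data.Nat.GCD using (module Bézout)
open import Data.Nat.Primality using (prime⇒nonTrivial)
open import Data.Nat.Primality.Factorisation using (factorise; PrimeFactorisation)
open import Data.Nat.Properties
open import Data.Nat.Tactic.RingSolver using (solve-∀)
open import Data.Product using (Σ; ∃; _×_; _,_; proj₁; proj₂)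
open import Data.Sum using (_⊎_; inj₁; inj₂; [_,_])
open import Data.Unit using (⊤; tt)
open import Function using (_∘_)
open import Level using (0ℓ)
open import Relation.Binary.Definitions using (tri<; tri≈; tri>)
open import Relation.Binary.PropositionalEquality
  using (_≡_; _≢_; refl; sym; trans; cong; cong₂; subst; module ≡-Reasoning)
open import Relation.Nullary using (Dec; yes; no; contradiction)
open import Relation.Nullary.Decidable using (_×-dec_; _⊎-dec_; ¬?; map′; decidable-stable)
open import Relation.Unary using (Pred; Decidable)
open import Algebra.Properties.CommutativeMonoid.Sum +-0-commutativeMonoid
  using (sum; ∑-distrib-+; ∑-comm; ∑-permute; sum-cong-≗)

-- The count behind the constant: every term of the sequence is either paid for by p elements of G,
-- and there are fewer than q = n/p such terms, or it lies in an unpaid part. The unpaid parts are a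
-- reserve X of 2m terms and a part with multiplicities at most 2m, which has at most (9m + 6)m
-- terms unless it contains another dense V. Together they have 9m² + 8m = 9p² - 10p + 1 terms, and
-- the strict inequality absorbs the 1. Two obstacles shape the argument. The term r that dominates
-- the rest is unknown when the reserve is chosen, so the reserve must contain m terms outside every
-- cyclic subgroup generated by a remaining term. And G is not abelian: left multiplication by y
-- moves yⁱ⟨r⟩ to the next coset, whereas right multiplication by r keeps each coset, so gains on
-- both sides are needed. For B to meet ⟨r⟩ in p points, up to m copies of each term are put into B
-- before the single terms are chosen.

ind : {P : Set} → Dec P → ℕ
ind (yes _) = 1
ind (no _)  = 0

ind-mono : {P Q : Set} (P? : Dec P) (Q? : Dec Q) → (P → Q) → ind P? ≤ ind Q?
ind-mono (no _)  _       f = z≤n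
ind-mono (yes _) (yes _) f = ≤-refl
ind-mono (yes p) (no ¬q) f = contradiction (f p) ¬q

sum-mono : ∀ {n} {f g : Fin n → ℕ} → (∀ i → f i ≤ g i) → sum f ≤ sum g
sum-mono {zero}  f≤g = z≤n
sum-mono {suc n} f≤g = +-mono-≤ (f≤g zero) (sum-mono (f≤g ∘ suc))

sum-const : ∀ {n} c → sum {n} (λ _ → c) ≡ n * c
sum-const {zero}  c = refl
sum-const {suc n} c = cong (c +_) (sum-const {n} c)

sum-scale : ∀ {n} c (f : Fin n → ℕ) → sum (λ i → c * f i) ≡ c * sum f
sum-scale {zero}  c f = sym (*-zeroʳ c)
sum-scale {suc n} c f =
  trans (cong (c * f zero +_) (sum-scale c (f ∘ suc))) (sym (*-distribˡ-+ c (f zero) _))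

sum-pos : ∀ {n} (f : Fin n → ℕ) → 1 ≤ sum f → ∃ λ i → 1 ≤ f i
sum-pos {suc n} f 1≤ with f zero in eq
... | suc k = zero , subst (1 ≤_) (sym eq) (s≤s z≤n)
... | zero  = let i , 1≤fi = sum-pos (f ∘ suc) 1≤ in suc i , 1≤fi

term≤sum : ∀ {n} (f : Fin n → ℕ) i → f i ≤ sum f
term≤sum f zero    = m≤m+n _ _
term≤sum f (suc i) = ≤-trans (term≤sum (f ∘ suc) i) (m≤n+m _ (f zero))

-- Cardinalities of decidable subsets of a finite set

card : ∀ {n} {P : Pred (Fin n) 0ℓ} → Decidable P → ℕ
card P? = sum (λ x → ind (P? x))

module _ {n : ℕ} {P : Pred (Fin n) 0ℓ} (P? : Decidable P) where

  card-≤n : card P? ≤ n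
  card-≤n = ≤-trans (sum-mono λ x → ind≤1 (P? x)) (≤-reflexive (trans (sum-const {n} 1) (*-identityʳ n)))
    where
    ind≤1 : {P : Set} (d : Dec P) → ind d ≤ 1
    ind≤1 (yes _) = ≤-refl
    ind≤1 (no _)  = z≤n

  card-pos : ∀ {x} → P x → 1 ≤ card P?
  card-pos {x} px = ≤-trans (ind-yes (P? x)) (term≤sum _ x)
    where
    ind-yes : (d : Dec (P x)) → 1 ≤ ind d
    ind-yes (yes _) = ≤-refl
    ind-yes (no ¬p) = contradiction px ¬p

  card-inhabited : 1 ≤ card P? → ∃ P
  card-inhabited 1≤ with sum-pos _ 1≤
  ... | x , 1≤i with P? x
  ...   | yes px = x , px

  card-permute : (f g : Fin n → Fin n) → (∀ x → f (g x) ≡ x) → (∀ x → g (f x) ≡ x) →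
                 card P? ≡ card (P? ∘ f)
  card-permute f g fg gf = ∑-permute (ind ∘ P?) (permutation f g fg gf)

  module _ {Q : Pred (Fin n) 0ℓ} (Q? : Decidable Q) where

    card-mono : (∀ x → P x → Q x) → card P? ≤ card Q?
    card-mono P⊆Q = sum-mono λ x → ind-mono (P? x) (Q? x) (P⊆Q x)

    card-split : card P? ≡ card (λ x → P? x ×-dec Q? x) + card (λ x → P? x ×-dec ¬? (Q? x))
    card-split = trans (sum-cong-≗ λ x → split (P? x) (Q? x))
      (∑-distrib-+ {n} (λ x → ind (P? x ×-dec Q? x)) (λ x → ind (P? x ×-dec ¬? (Q? x))))
      where
      split : {A B : Set} (a : Dec A) (b : Dec B) → ind a ≡ ind (a ×-dec b) + ind (a ×-dec ¬? b)
      split (yes _) (yes _) = refl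
      split (yes _) (no _)  = refl
      split (no _)  (yes _) = refl
      split (no _)  (no _)  = refl

    module _ {R : Pred (Fin n) 0ℓ} (R? : Decidable R) where

      card-disjoint : (∀ x → P x → R x) → (∀ x → Q x → R x) → (∀ x → P x → ¬ Q x) →
                      card P? + card Q? ≤ card R?
      card-disjoint P⊆R Q⊆R P∩Q =
        subst (_≤ card R?) (∑-distrib-+ (ind ∘ P?) (ind ∘ Q?))
          (sum-mono λ x → aux (P? x) (Q? x) (R? x) (P⊆R x) (Q⊆R x) (P∩Q x))
        where
        aux : {A B C : Set} (a : Dec A) (b : Dec B) (c : Dec C) → (A → C) → (B → C) → (A → ¬ B) →
              ind a + ind b ≤ ind c
        aux (yes x) (yes y) c f g h = contradiction y (h x)
        aux (yes x) (no _)  c f g h = ind-mono (yes x) c f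
        aux (no _)  b       c f g h = ind-mono b c g

      card-cover : (∀ x → R x → P x ⊎ Q x) → card R? ≤ card P? + card Q?
      card-cover R⊆ =
        subst (card R? ≤_) (∑-distrib-+ (ind ∘ P?) (ind ∘ Q?))
          (sum-mono λ x → aux (P? x) (Q? x) (R? x) (R⊆ x))
        where
        aux : {A B C : Set} (a : Dec A) (b : Dec B) (c : Dec C) → (C → A ⊎ B) → ind c ≤ ind a + ind b
        aux a       b       (no _)  f = z≤n
        aux (yes _) b       (yes _) f = s≤s z≤n
        aux (no _)  (yes _) (yes _) f = ≤-refl
        aux (no ¬a) (no ¬b) (yes c) f = ⊥-elim ([ ¬a , ¬b ] (f c))

-- Both sides equal the common cardinality minus |P ∩ Q|. Applied to B and a translate of B, it says
-- that as many points enter B as leave it.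
card-exchange : ∀ {n} {P Q : Pred (Fin n) 0ℓ} (P? : Decidable P) (Q? : Decidable Q) → card P? ≡ card Q? →
                card (λ x → P? x ×-dec ¬? (Q? x)) ≡ card (λ x → Q? x ×-dec ¬? (P? x))
card-exchange P? Q? P≡Q = +-cancelˡ-≡ (card P∩Q?) _ _
  (trans (sym (card-split P? Q?)) (trans P≡Q (trans (card-split Q? P?) (cong (_+ card (λ x → Q? x ×-dec ¬? (P? x))) Q∩P≡P∩Q))))
  where
  P∩Q? = λ x → P? x ×-dec Q? x
  Q∩P? = λ x → Q? x ×-dec P? x
  Q∩P≡P∩Q : card Q∩P? ≡ card P∩Q?
  Q∩P≡P∩Q = ≤-antisym (card-mono Q∩P? P∩Q? λ _ (q , p) → p , q) (card-mono P∩Q? Q∩P? λ _ (p , q) → q , p)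

card-blocks : ∀ {n k c} {P : Pred (Fin n) 0ℓ} (P? : Decidable P)
              {Q : Fin k → Pred (Fin n) 0ℓ} (Q? : ∀ i → Decidable (Q i)) →
              (∀ i → c ≤ card (Q? i)) → (∀ i x → Q i x → P x) →
              (∀ i j x → Q i x → Q j x → i ≡ j) → k * c ≤ card P?
card-blocks {k = zero}          P? Q? c≤ Q⊆P disj = z≤n
card-blocks {k = suc k} {P = P} P? {Q} Q? c≤ Q⊆P disj =
  ≤-trans (+-mono-≤ (c≤ zero)
             (card-blocks rest? (Q? ∘ suc) (c≤ ∘ suc)
               (λ i x q → Q⊆P (suc i) x q , λ q₀ → case-0≡suc (disj zero (suc i) x q₀ q))
               (λ i j x qi qj → suc-inj (disj (suc i) (suc j) x qi qj))))
          (card-disjoint (Q? zero) rest? P? (Q⊆P zero) (λ _ → proj₁) (λ _ q r → proj₂ r q))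
  where
  rest? : Decidable (λ x → P x × ¬ Q zero x)
  rest? x = P? x ×-dec ¬? (Q? zero x)
  case-0≡suc : ∀ {i : Fin k} → ¬ (zero ≡ Fin.suc i)
  case-0≡suc ()
  suc-inj : ∀ {i j : Fin k} → Fin.suc i ≡ suc j → i ≡ j
  suc-inj refl = refl

card-injection : ∀ {n k} {P : Pred (Fin n) 0ℓ} (P? : Decidable P) (f : Fin k → Fin n) →
                 (∀ i → P (f i)) → (∀ i j → f i ≡ f j → i ≡ j) → k ≤ card P?
card-injection {k = k} P? f Pf inj =
  subst (_≤ card P?) (*-identityʳ k)
    (card-blocks P? (λ i x → x ≟ᶠ f i) (λ i → card-pos (λ x → x ≟ᶠ f i) refl)
      (λ i x eq → subst _ (sym eq) (Pf i))
      (λ i j x x≡fi x≡fj → inj i j (trans (sym x≡fi) x≡fj)))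

card-empty : ∀ {n} {P : Pred (Fin n) 0ℓ} (P? : Decidable P) → (∀ x → ¬ P x) → card P? ≡ 0
card-empty P? ¬P with card P? in eq
... | zero  = refl
... | suc k = let x , px = card-inhabited P? (subst (1 ≤_) (sym eq) (s≤s z≤n)) in contradiction px (¬P x)

card-subsingleton : ∀ {n} {P : Pred (Fin n) 0ℓ} (P? : Decidable P) →
                    (∀ x y → P x → P y → x ≡ y) → card P? ≤ 1
card-subsingleton {zero}  P? _ = z≤n
card-subsingleton {suc n} P? unique with P? zero
... | yes p₀ = s≤s (≤-reflexive (card-empty (P? ∘ suc) λ x px → case-0≡suc (unique zero (suc x) p₀ px)))
  where
  case-0≡suc : ∀ {i : Fin n} → ¬ (zero ≡ Fin.suc i)
  case-0≡suc ()
... | no _   = card-subsingleton (P? ∘ suc) λ x y px py → suc-inj (unique (suc x) (suc y) px py)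
  where
  suc-inj : ∀ {i j : Fin n} → Fin.suc i ≡ suc j → i ≡ j
  suc-inj refl = refl

module FreeSequences {n : ℕ} (G : FiniteGroup n) where

  open FiniteGroup G renaming (_∙_ to infixl 7 _·_)
  open IsGroup isGroup using (assoc; identityˡ; identityʳ; inverseˡ; inverseʳ)

  group : Group 0ℓ 0ℓ
  group = record { isGroup = isGroup }

  open GroupProperties group using
    (∙-cancelˡ; inverseˡ-unique; inverseʳ-unique; ⁻¹-involutive; ε⁻¹≈ε; ⁻¹-anti-homo-∙)


  x·y⁻¹·y : ∀ x y → x · y ⁻¹ · y ≡ x
  x·y⁻¹·y x y = trans (assoc x (y ⁻¹) y) (trans (cong (x ·_) (inverseˡ y)) (identityʳ x))

  x·y·y⁻¹ : ∀ x y → x · y · y ⁻¹ ≡ x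
  x·y·y⁻¹ x y = trans (assoc x y (y ⁻¹)) (trans (cong (x ·_) (inverseʳ y)) (identityʳ x))

  y·y⁻¹·x : ∀ x y → y · (y ⁻¹ · x) ≡ x
  y·y⁻¹·x x y = trans (sym (assoc y (y ⁻¹) x)) (trans (cong (_· x) (inverseʳ y)) (identityˡ x))

  y⁻¹·y·x : ∀ x y → y ⁻¹ · (y · x) ≡ x
  y⁻¹·y·x x y = trans (sym (assoc (y ⁻¹) y x)) (trans (cong (_· x) (inverseˡ y)) (identityˡ x))

  -- Translates of subsets and Kemperman's theorem

  Subset : Set₁
  Subset = Pred (Fin n) 0ℓ

  module _ {P : Subset} (P? : Decidable P) where

    card-·ʳ : ∀ y → card P? ≡ card (λ x → P? (x · y))
    card-·ʳ y = card-permute P? (_· y) (_· y ⁻¹) (λ x → x·y⁻¹·y x y) (λ x → x·y·y⁻¹ x y)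

    card-·ˡ : ∀ y → card P? ≡ card (λ x → P? (y · x))
    card-·ˡ y = card-permute P? (y ·_) (y ⁻¹ ·_) (λ x → y·y⁻¹·x x y) (λ x → y⁻¹·y·x x y)

    card-⁻¹ : card P? ≡ card (λ x → P? (x ⁻¹))
    card-⁻¹ = card-permute P? _⁻¹ _⁻¹ ⁻¹-involutive ⁻¹-involutive

  -- If A and B meet only in ε then A ∪ B ⊆ AB; otherwise a nontrivial e ∈ A ∩ B
  -- gives the transforms (A ∪ Ae, B ∩ e⁻¹B) and (A ∩ Ae⁻¹, B ∪ eB), which keep
  -- the uniqueness of the product ε and of which one does not lower |A| + |B|.
  kemperman-fuel : ∀ k l {A B Z : Subset} (A? : Decidable A) (B? : Decidable B) (Z? : Decidable Z) →
    n + n ≤ card A? + card B? + k → card B? ≤ l → A ε → B ε →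
    (∀ a b → A a → B b → a · b ≡ ε → a ≡ ε) → (∀ a b → A a → B b → Z (a · b)) →
    card A? + card B? ≤ suc (card Z?)
  kemperman-fuel k l {A} {B} {Z} A? B? Z? k-bound l-bound Aε Bε unique AB⊆Z
    with any? (λ e → (A? e ×-dec B? e) ×-dec ¬? (e ≟ᶠ ε))
  ... | no ¬e = begin
      card A? + card B?                  ≤⟨ +-monoʳ-≤ (card A?) B≤ ⟩
      card A? + (1 + card B∖ε?)          ≡⟨ +-suc (card A?) _ ⟩
      suc (card A? + card B∖ε?)          ≤⟨ s≤s A+B≤Z ⟩
      suc (card Z?)                      ∎
    where
    open ≤-Reasoning
    B∖ε? : Decidable (λ x → B x × ¬ (x ≡ ε))
    B∖ε? x = B? x ×-dec ¬? (x ≟ᶠ ε)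
    B≤ : card B? ≤ 1 + card B∖ε?
    B≤ = ≤-trans (card-cover (_≟ᶠ ε) B∖ε? B? λ x bx → case x bx (x ≟ᶠ ε))
           (+-monoˡ-≤ (card B∖ε?) (card-subsingleton (_≟ᶠ ε) λ x y x≡ y≡ → trans x≡ (sym y≡)))
      where
      case : ∀ x → B x → Dec (x ≡ ε) → x ≡ ε ⊎ (B x × ¬ (x ≡ ε))
      case x bx (yes x≡ε) = inj₁ x≡ε
      case x bx (no x≢ε)  = inj₂ (bx , x≢ε)
    A+B≤Z : card A? + card B∖ε? ≤ card Z?
    A+B≤Z = card-disjoint A? B∖ε? Z?
      (λ x ax → subst Z (identityʳ x) (AB⊆Z x ε ax Bε))
      (λ x bx → subst Z (identityˡ x) (AB⊆Z ε x Aε (proj₁ bx)))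
      (λ x ax bx → ¬e (x , (ax , proj₁ bx) , proj₂ bx))
  ... | yes (e , (Ae , Be) , e≢ε) = transform k l k-bound l-bound
    where
    open ≤-Reasoning
    α? : Decidable (λ x → A x × ¬ A (x · e))
    α? x = A? x ×-dec ¬? (A? (x · e))
    β? : Decidable (λ x → B x × ¬ B (e · x))
    β? x = B? x ×-dec ¬? (B? (e · x))

    ¬Ae⁻¹ : ¬ A (e ⁻¹)
    ¬Ae⁻¹ a = e≢ε (trans (sym (⁻¹-involutive e))
                (trans (cong _⁻¹ (unique (e ⁻¹) e a Be (inverseˡ e))) ε⁻¹≈ε))
    ¬Be⁻¹ : ¬ B (e ⁻¹)
    ¬Be⁻¹ b = e≢ε (unique e (e ⁻¹) Ae b (inverseʳ e))

    A₁? : Decidable (λ x → A x ⊎ A (x · e ⁻¹))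
    A₁? x = A? x ⊎-dec A? (x · e ⁻¹)
    B₁? : Decidable (λ x → B x × B (e · x))
    B₁? x = B? x ×-dec B? (e · x)
    A₂? : Decidable (λ x → A x × A (x · e))
    A₂? x = A? x ×-dec A? (x · e)
    B₂? : Decidable (λ x → B x ⊎ B (e ⁻¹ · x))
    B₂? x = B? x ⊎-dec B? (e ⁻¹ · x)

    A₁≥ : card A? + card α? ≤ card A₁?
    A₁≥ = subst (λ c → card A? + c ≤ card A₁?) (sym (card-·ʳ α? (e ⁻¹)))
      (card-disjoint A? (λ x → α? (x · e ⁻¹)) A₁? (λ _ → inj₁) (λ _ → inj₂ ∘ proj₁)
        (λ x ax q → proj₂ q (subst A (sym (x·y⁻¹·y x e)) ax)))
    B₁≡ : card B? ≡ card B₁? + card β?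
    B₁≡ = card-split B? (λ x → B? (e · x))
    A₂≡ : card A? ≡ card A₂? + card α?
    A₂≡ = card-split A? (λ x → A? (x · e))
    B₂≥ : card B? + card β? ≤ card B₂?
    B₂≥ = subst (λ c → card B? + c ≤ card B₂?) (sym (card-·ˡ β? (e ⁻¹)))
      (card-disjoint B? (λ x → β? (e ⁻¹ · x)) B₂? (λ _ → inj₁) (λ _ → inj₂ ∘ proj₁)
        (λ x bx q → proj₂ q (subst B (sym (y·y⁻¹·x x e)) bx)))

    -- |B ∖ e⁻¹B| = |e⁻¹B ∖ B|, and e⁻¹ lies in e⁻¹B ∖ B.
    β-pos : 1 ≤ card β?
    β-pos = ≤-trans (card-pos (λ x → B? (e · x) ×-dec ¬? (B? x)) (subst B (sym (inverseʳ e)) Bε , ¬Be⁻¹))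
      (≤-reflexive (sym (card-exchange B? (λ x → B? (e · x)) (card-·ˡ B? e))))

    unique₁ : ∀ a b → A a ⊎ A (a · e ⁻¹) → B b × B (e · b) → a · b ≡ ε → a ≡ ε
    unique₁ a b (inj₁ Aa) (Bb , _)  ab≡ε = unique a b Aa Bb ab≡ε
    unique₁ a b (inj₂ Aa) (Bb , Beb) ab≡ε = contradiction (subst B b≡e⁻¹ Bb) ¬Be⁻¹
      where
      ae⁻¹≡ε : a · e ⁻¹ ≡ ε
      ae⁻¹≡ε = unique (a · e ⁻¹) (e · b) Aa Beb
        (trans (sym (assoc _ e b)) (trans (cong (_· b) (x·y⁻¹·y a e)) ab≡ε))
      a≡e : a ≡ e
      a≡e = trans (sym (x·y⁻¹·y a e)) (trans (cong (_· e) ae⁻¹≡ε) (identityˡ e))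
      b≡e⁻¹ : b ≡ e ⁻¹
      b≡e⁻¹ = inverseʳ-unique e b (trans (cong (_· b) (sym a≡e)) ab≡ε)

    unique₂ : ∀ a b → A a × A (a · e) → B b ⊎ B (e ⁻¹ · b) → a · b ≡ ε → a ≡ ε
    unique₂ a b (Aa , _)   (inj₁ Bb) ab≡ε = unique a b Aa Bb ab≡ε
    unique₂ a b (Aa , Aae) (inj₂ Bb) ab≡ε = contradiction (subst A a≡e⁻¹ Aa) ¬Ae⁻¹
      where
      ae≡ε : a · e ≡ ε
      ae≡ε = unique (a · e) (e ⁻¹ · b) Aae Bb
        (trans (sym (assoc _ (e ⁻¹) b)) (trans (cong (_· b) (x·y·y⁻¹ a e)) ab≡ε))
      a≡e⁻¹ : a ≡ e ⁻¹
      a≡e⁻¹ = inverseˡ-unique a e ae≡ε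

    AB₁⊆Z : ∀ a b → A a ⊎ A (a · e ⁻¹) → B b × B (e · b) → Z (a · b)
    AB₁⊆Z a b (inj₁ Aa) (Bb , _)   = AB⊆Z a b Aa Bb
    AB₁⊆Z a b (inj₂ Aa) (_  , Beb) =
      subst Z (trans (sym (assoc _ e b)) (cong (_· b) (x·y⁻¹·y a e))) (AB⊆Z _ _ Aa Beb)

    AB₂⊆Z : ∀ a b → A a × A (a · e) → B b ⊎ B (e ⁻¹ · b) → Z (a · b)
    AB₂⊆Z a b (Aa , _)   (inj₁ Bb) = AB⊆Z a b Aa Bb
    AB₂⊆Z a b (_  , Aae) (inj₂ Bb) =
      subst Z (trans (sym (assoc _ (e ⁻¹) b)) (cong (_· b) (x·y·y⁻¹ a e))) (AB⊆Z _ _ Aae Bb)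

    sum₁ : card β? ≤ card α? → card A? + card B? ≤ card A₁? + card B₁?
    sum₁ β≤α = begin
      card A? + card B?                ≡⟨ cong (card A? +_) B₁≡ ⟩
      card A? + (card B₁? + card β?)   ≤⟨ +-monoʳ-≤ (card A?) (+-monoʳ-≤ (card B₁?) β≤α) ⟩
      card A? + (card B₁? + card α?)   ≡⟨ cong (card A? +_) (+-comm (card B₁?) _) ⟩
      card A? + (card α? + card B₁?)   ≡⟨ sym (+-assoc (card A?) _ _) ⟩
      card A? + card α? + card B₁?     ≤⟨ +-monoˡ-≤ (card B₁?) A₁≥ ⟩
      card A₁? + card B₁?              ∎

    sum₂ : card α? < card β? → card A? + card B? < card A₂? + card B₂?
    sum₂ α<β = begin-strict
      card A? + card B?                ≡⟨ cong (_+ card B?) A₂≡ ⟩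
      card A₂? + card α? + card B?     ≡⟨ +-assoc (card A₂?) _ _ ⟩
      card A₂? + (card α? + card B?)   <⟨ +-monoʳ-< (card A₂?) (+-monoˡ-< (card B?) α<β) ⟩
      card A₂? + (card β? + card B?)   ≡⟨ cong (card A₂? +_) (+-comm (card β?) _) ⟩
      card A₂? + (card B? + card β?)   ≤⟨ +-monoʳ-≤ (card A₂?) B₂≥ ⟩
      card A₂? + card B₂?              ∎

    Bε₁ : B ε × B (e · ε)
    Bε₁ = Bε , subst B (sym (identityʳ e)) Be
    Aε₂ : A ε × A (ε · e)
    Aε₂ = Aε , subst A (sym (identityˡ e)) Ae

    B₁<B : card B₁? < card B?
    B₁<B = begin-strict
      card B₁?             <⟨ m<m+n (card B₁?) β-pos ⟩
      card B₁? + card β?   ≡⟨ sym B₁≡ ⟩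
      card B?              ∎

    transform : ∀ k l → n + n ≤ card A? + card B? + k → card B? ≤ l →
                card A? + card B? ≤ suc (card Z?)
    -- The recursion is lexicographic. The first transform keeps |A| + |B| from dropping and lowers
    -- |B|, bounded by `l`; the second raises |A| + |B|, which is at most 2n, so `k` falls and the
    -- bound on |B| is reset to n.
    transform k l k-bound l-bound with card β? ≤? card α?
    transform k zero    k-bound l-bound | yes β≤α = contradiction (≤-trans (card-pos B? Bε) l-bound) λ()
    transform k (suc l) k-bound l-bound | yes β≤α = ≤-trans (sum₁ β≤α)
      (kemperman-fuel k l A₁? B₁? Z? (≤-trans k-bound (+-monoˡ-≤ k (sum₁ β≤α)))
        (≤-pred (≤-trans B₁<B l-bound)) (inj₁ Aε) Bε₁ unique₁ AB₁⊆Z)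
    transform zero    l k-bound l-bound | no β≰α = contradiction
      (≤-trans (s≤s (subst (n + n ≤_) (+-identityʳ _) k-bound)) (sum₂ (≰⇒> β≰α)))
      (≤⇒≯ (+-mono-≤ (card-≤n A₂?) (card-≤n B₂?)))
    transform (suc k) l k-bound l-bound | no β≰α = ≤-trans (<⇒≤ (sum₂ (≰⇒> β≰α)))
      (kemperman-fuel k n A₂? B₂? Z?
        (≤-trans k-bound (≤-trans (≤-reflexive (+-suc _ k)) (+-monoˡ-≤ k (sum₂ (≰⇒> β≰α)))))
        (card-≤n B₂?) Aε₂ (inj₁ Bε) unique₂ AB₂⊆Z)

  -- Both transforms replace AB by a subset of itself. Stating the bound for a superset `Z` of AB
  -- keeps `Z` fixed through the recursion.
  kemperman : {A B Z : Subset} (A? : Decidable A) (B? : Decidable B) (Z? : Decidable Z) →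
    A ε → B ε → (∀ a b → A a → B b → a · b ≡ ε → a ≡ ε) → (∀ a b → A a → B b → Z (a · b)) →
    card A? + card B? ≤ suc (card Z?)
  kemperman A? B? Z? =
    kemperman-fuel (n + n) n A? B? Z? (m≤n+m (n + n) (card A? + card B?)) (card-≤n B?)

  -- Sequences as multiplicity functions

  -- A sequence over G is encoded by its multiplicity function.
  Multiset : Set
  Multiset = Fin n → ℕ

  infix  4 _≼_
  infixl 6 _⊕_ _⊖_

  _≼_ : Multiset → Multiset → Set
  μ ≼ ν = ∀ g → μ g ≤ ν g

  _⊕_ _⊖_ : Multiset → Multiset → Multiset
  (μ ⊕ ν) g = μ g + ν g
  (μ ⊖ ν) g = μ g ∸ ν g

  ∅ : Multiset
  ∅ _ = 0

  δ : Fin n → Multiset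
  δ g x = ind (x ≟ᶠ g)

  size : Multiset → ℕ
  size μ = sum μ

  count : List (Fin n) → Multiset
  count []      = ∅
  count (g ∷ w) = δ g ⊕ count w

  δ-self : ∀ g → δ g g ≡ 1
  δ-self g with g ≟ᶠ g
  ... | yes _  = refl
  ... | no g≢g = contradiction refl g≢g

  δ≼ : ∀ {μ : Multiset} {g} → 1 ≤ μ g → δ g ≼ μ
  δ≼ {g = g} 1≤μg x with x ≟ᶠ g
  ... | yes refl = 1≤μg
  ... | no _     = z≤n

  δ≼⁻ : ∀ {μ : Multiset} {g} → δ g ≼ μ → 1 ≤ μ g
  δ≼⁻ {μ} {g} δ≤ = subst (_≤ μ g) (δ-self g) (δ≤ g)

  size-⊕ : ∀ μ ν → size (μ ⊕ ν) ≡ size μ + size ν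
  size-⊕ μ ν = ∑-distrib-+ μ ν

  size-mono : ∀ {μ ν} → μ ≼ ν → size μ ≤ size ν
  size-mono = sum-mono

  size-cong : ∀ {μ ν : Multiset} → (∀ g → μ g ≡ ν g) → size μ ≡ size ν
  size-cong {μ} {ν} = sum-cong-≗ {n} {μ} {ν}

  size-δ : ∀ g → size (δ g) ≡ 1
  size-δ g = ≤-antisym (card-subsingleton (_≟ᶠ g) λ x y x≡ y≡ → trans x≡ (sym y≡))
                       (card-pos (_≟ᶠ g) refl)

  size-⊖ : ∀ {μ ν : Multiset} → ν ≼ μ → size μ ≡ size ν + size (μ ⊖ ν)
  size-⊖ {μ} {ν} ν≼μ = trans (size-cong {μ} {ν ⊕ (μ ⊖ ν)} λ g → sym (m+[n∸m]≡n (ν≼μ g))) (size-⊕ ν (μ ⊖ ν))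

  size-∅ : size ∅ ≡ 0
  size-∅ = trans (sum-const {n} 0) (*-zeroʳ n)

  count-++ : ∀ v w g → count (v ++ w) g ≡ count v g + count w g
  count-++ []      w g = refl
  count-++ (x ∷ v) w g = trans (cong (δ x g +_) (count-++ v w g)) (sym (+-assoc (δ x g) _ _))

  size-count : ∀ w → size (count w) ≡ length w
  size-count []      = size-∅
  size-count (g ∷ w) = trans (size-⊕ (δ g) (count w)) (cong₂ _+_ (size-δ g) (size-count w))

  prod-++ : ∀ v w → prod G (v ++ w) ≡ prod G v · prod G w
  prod-++ []      w = sym (identityˡ _)
  prod-++ (x ∷ v) w = trans (cong (x ·_) (prod-++ v w)) (sym (assoc x _ _))

  -- One-product free sequences and their sets of subsequence products

  -- The words `x ∷ w` with bounded count are exactly the orderings of nonempty subsequences, so one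
  -- condition covers both the choice of a subsequence and its ordering.
  Free : Multiset → Set
  Free σ = ∀ x w → count (x ∷ w) ≼ σ → prod G (x ∷ w) ≢ ε

  Free-mono : ∀ {μ σ} → μ ≼ σ → Free σ → Free μ
  Free-mono μ≼σ free x w c = free x w (λ g → ≤-trans (c g) (μ≼σ g))

  Π : Multiset → Subset
  Π μ x = ∃ λ w → count w ≼ μ × prod G w ≡ x

  -- A word counted by μ has length at most `size μ`, so a bounded search suffices: a first factor g
  -- leaves g⁻¹x to be written with the terms of `μ ⊖ δ g`.
  Π? : ∀ μ → Decidable (Π μ)
  Π? μ x = map′ (λ (w , _ , c , p) → w , c , p)
                (λ (w , c , p) → w , subst (_≤ size μ) (size-count w) (size-mono c) , c , p)
                (bounded (size μ) μ x)
    where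
    bounded : ∀ k μ x → Dec (∃ λ w → length w ≤ k × count w ≼ μ × prod G w ≡ x)
    bounded zero μ x = map′ (λ x≡ε → [] , z≤n , (λ _ → z≤n) , sym x≡ε)
                            (λ { ([] , _ , _ , p) → sym p ; (_ ∷ _ , () , _) }) (x ≟ᶠ ε)
    bounded (suc k) μ x = map′ to from
      (x ≟ᶠ ε ⊎-dec any? λ g → (1 ≤? μ g) ×-dec bounded k (μ ⊖ δ g) (g ⁻¹ · x))
      where
      to : _ → ∃ λ w → length w ≤ suc k × count w ≼ μ × prod G w ≡ x
      to (inj₁ x≡ε) = [] , z≤n , (λ _ → z≤n) , sym x≡ε
      to (inj₂ (g , 1≤ , w , l , c , p)) = g ∷ w , s≤s l ,
        (λ y → ≤-trans (+-monoʳ-≤ (δ g y) (c y)) (≤-reflexive (m+[n∸m]≡n (δ≼ {μ} 1≤ y)))) ,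
        trans (cong (g ·_) p) (y·y⁻¹·x x g)
      from : (∃ λ w → length w ≤ suc k × count w ≼ μ × prod G w ≡ x) → _
      from ([]    , _     , c , p) = inj₁ (sym p)
      from (g ∷ w , s≤s l , c , p) = inj₂ (g , δ≼⁻ {μ} (λ y → ≤-trans (m≤m+n _ _) (c y)) , w , l ,
        (λ y → ≤-trans (≤-reflexive (sym (m+n∸m≡n (δ g y) _))) (∸-monoˡ-≤ (δ g y) (c y))) ,
        trans (sym (y⁻¹·y·x _ g)) (cong (g ⁻¹ ·_) p))

  ∣Π_∣ : Multiset → ℕ
  ∣Π μ ∣ = card (Π? μ)

  ε∈Π : ∀ {μ} → Π μ ε
  ε∈Π = [] , (λ _ → z≤n) , refl

  Π-mono : ∀ {μ ν} → μ ≼ ν → ∀ {x} → Π μ x → Π ν x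
  Π-mono μ≼ν (w , c , p) = w , (λ g → ≤-trans (c g) (μ≼ν g)) , p

  ∣Π∣-mono : ∀ {μ ν} → μ ≼ ν → ∣Π μ ∣ ≤ ∣Π ν ∣
  ∣Π∣-mono {μ} {ν} μ≼ν = card-mono (Π? μ) (Π? ν) λ _ → Π-mono μ≼ν

  Π-· : ∀ {μ ν τ} → μ ⊕ ν ≼ τ → ∀ {x y} → Π μ x → Π ν y → Π τ (x · y)
  Π-· μν≼τ (v , c , p) (w , d , q) = v ++ w ,
    (λ g → ≤-trans (≤-reflexive (count-++ v w g)) (≤-trans (+-mono-≤ (c g) (d g)) (μν≼τ g))) ,
    trans (prod-++ v w) (cong₂ _·_ p q)

  Π-δ : ∀ g → Π (δ g) g
  Π-δ g = g ∷ [] , (λ x → ≤-reflexive (+-identityʳ _)) , identityʳ g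

  Π-single : ∀ {μ : Multiset} {g} → 1 ≤ μ g → Π μ g
  Π-single {μ} {g} 1≤μg = Π-mono (δ≼ {μ} 1≤μg) (Π-δ g)

  -- A nonempty word for `x` followed by a word for `y` would be a forbidden word of σ. This is the
  -- uniqueness hypothesis of `kemperman`.
  Free-Π : ∀ {μ ν σ} → Free σ → μ ⊕ ν ≼ σ → ∀ {x y} → Π μ x → Π ν y → x · y ≡ ε → x ≡ ε
  Free-Π free μν≼σ ([]    , _ , p) _ _ = sym p
  Free-Π free μν≼σ (g ∷ v , c , p) (w , d , q) xy≡ε =
    contradiction (trans (prod-++ (g ∷ v) w) (trans (cong₂ _·_ p q) xy≡ε))
      (free g (v ++ w) λ z → ≤-trans (≤-reflexive (count-++ (g ∷ v) w z))
        (≤-trans (+-mono-≤ (c z) (d z)) (μν≼σ z)))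

  Free-g≢ε : ∀ {σ : Multiset} → Free σ → ∀ {g} → 1 ≤ σ g → g ≢ ε
  Free-g≢ε {σ} free {g} 1≤σg g≡ε =
    free g [] (λ x → subst (_≤ σ x) (sym (+-identityʳ _)) (δ≼ {σ} 1≤σg x)) (trans (identityʳ g) g≡ε)

  ∣Π∣-additive : ∀ {μ ν τ} → Free τ → μ ⊕ ν ≼ τ → ∣Π μ ∣ + ∣Π ν ∣ ≤ suc ∣Π τ ∣
  ∣Π∣-additive {μ} {ν} {τ} free μν≼τ =
    kemperman (Π? μ) (Π? ν) (Π? τ) (ε∈Π {μ}) (ε∈Π {ν})
      (λ _ _ → Free-Π free μν≼τ) (λ _ _ → Π-· μν≼τ)

  ∣Π∣-δ : ∀ {g} → g ≢ ε → 2 ≤ ∣Π δ g ∣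
  ∣Π∣-δ {g} g≢ε = ≤-trans (+-mono-≤ (card-pos (_≟ᶠ ε) refl) (card-pos (_≟ᶠ g) refl))
    (card-disjoint (_≟ᶠ ε) (_≟ᶠ g) (Π? (δ g))
      (λ { _ refl → ε∈Π {δ g} }) (λ { _ refl → Π-δ g }) (λ { _ refl ε≡g → g≢ε (sym ε≡g) }))

  ∣Π∣-suc : ∀ {μ ν : Multiset} {g} → Free ν → g ≢ ε → μ ⊕ δ g ≼ ν → suc ∣Π μ ∣ ≤ ∣Π ν ∣
  ∣Π∣-suc {μ} {ν} {g} free g≢ε μδ≼ν = ≤-pred (≤-trans
    (≤-trans (≤-reflexive (+-comm 2 ∣Π μ ∣)) (+-monoʳ-≤ ∣Π μ ∣ (∣Π∣-δ g≢ε)))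
    (∣Π∣-additive {μ} {δ g} {ν} free μδ≼ν))

  -- Every term differs from ε, so by superadditivity it adds at least one product to the initial
  -- product ε.
  size<∣Π∣ : ∀ {μ} → Free μ → size μ < ∣Π μ ∣
  size<∣Π∣ {μ} = go (size μ) μ refl
    where
    go : ∀ k μ → size μ ≡ k → Free μ → k < ∣Π μ ∣
    go zero    μ _  free = card-pos (Π? μ) (ε∈Π {μ})
    go (suc k) μ eq free =
      let g , 1≤μg = sum-pos μ (subst (1 ≤_) (sym eq) (s≤s z≤n))
          δg≼μ : δ g ≼ μ
          δg≼μ = δ≼ {μ} 1≤μg
          size≡ : size (μ ⊖ δ g) ≡ k
          size≡ = suc-injective (trans (trans (cong (_+ size (μ ⊖ δ g)) (sym (size-δ g))) (sym (size-⊖ {μ} {δ g} δg≼μ))) eq)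
      in ≤-trans (s≤s (go k (μ ⊖ δ g) size≡ (Free-mono (λ x → m∸n≤m (μ x) (δ g x)) free)))
           (∣Π∣-suc {μ ⊖ δ g} {μ} free (Free-g≢ε free 1≤μg) (λ x → ≤-reflexive (m∸n+n≡m (δg≼μ x))))

  -- Olson's function λ

  module Gain {B : Subset} (B? : Decidable B) where

    leaves? : ∀ h → Decidable (λ x → B x × ¬ B (x · h))
    leaves? h x = B? x ×-dec ¬? (B? (x · h))

    -- Olson's λ_B(h) = |Bh ∖ B|, counted inside B.
    gain : Fin n → ℕ
    gain h = card (leaves? h)

    gain-ε : gain ε ≡ 0
    gain-ε = card-empty (leaves? ε) λ x (bx , ¬bxε) → ¬bxε (subst B (sym (identityʳ x)) bx)

    -- On the way from x ∈ B over xg to xgh ∉ B, the set B is left either at the first step or at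
    -- the second.
    gain-· : ∀ g h → gain (g · h) ≤ gain g + gain h
    gain-· g h = subst (λ c → gain (g · h) ≤ gain g + c) (sym (card-·ʳ (leaves? h) g))
      (card-cover (leaves? g) (λ x → leaves? h (x · g)) (leaves? (g · h)) λ x (bx , ¬b) → split x bx ¬b (B? (x · g)))
      where
      split : ∀ x → B x → ¬ B (x · (g · h)) → Dec (B (x · g)) →
              (B x × ¬ B (x · g)) ⊎ (B (x · g) × ¬ B (x · g · h))
      split x bx ¬b (yes b) = inj₂ (b , λ b′ → ¬b (subst B (assoc x g h) b′))
      split x bx ¬b (no ¬b′) = inj₁ (bx , ¬b′)

    gain-⁻¹ : ∀ h → gain (h ⁻¹) ≡ gain h
    gain-⁻¹ h = begin
      gain (h ⁻¹)                                  ≡⟨ card-·ʳ (leaves? (h ⁻¹)) h ⟩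
      card (λ x → leaves? (h ⁻¹) (x · h))          ≡⟨ ≤-antisym
        (card-mono (λ x → leaves? (h ⁻¹) (x · h)) enters? λ x (p , ¬q) → p , λ q → ¬q (subst B (sym (x·y·y⁻¹ x h)) q))
        (card-mono enters? (λ x → leaves? (h ⁻¹) (x · h)) λ x (p , ¬q) → p , λ q → ¬q (subst B (x·y·y⁻¹ x h) q)) ⟩
      card enters?                                 ≡⟨ card-exchange (λ x → B? (x · h)) B? (sym (card-·ʳ B? h)) ⟩
      gain h                                       ∎
      where
      open ≡-Reasoning
      enters? : Decidable (λ x → B (x · h) × ¬ B x)
      enters? x = B? (x · h) ×-dec ¬? (B? x)

    -- Double counting the pairs (x, h) with x, xh ∈ B and h ∈ F.
    gain-average : ∀ {F : Subset} (F? : Decidable F) t → (∀ h → F h → gain h ≤ t) →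
                   card F? * card B? ≤ card F? * t + card B? * card B?
    gain-average {F} F? t gain≤t = begin
      card F? * card B?                     ≡⟨ *-comm (card F?) (card B?) ⟩
      card B? * card F?                     ≡⟨ sym (sum-scale (card B?) (ind ∘ F?)) ⟩
      sum (λ h → card B? * ind (F? h))      ≤⟨ sum-mono row ⟩
      sum (λ h → t * ind (F? h) + sum (λ x → ind (B? x ×-dec B? (x · h))))
        ≡⟨ ∑-distrib-+ (λ h → t * ind (F? h)) (λ h → sum (λ x → ind (B? x ×-dec B? (x · h)))) ⟩
      sum (λ h → t * ind (F? h)) + sum (λ h → sum (λ x → ind (B? x ×-dec B? (x · h))))
        ≡⟨ cong₂ _+_ (sum-scale t (ind ∘ F?)) (∑-comm (λ h x → ind (B? x ×-dec B? (x · h)))) ⟩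
      t * card F? + sum (λ x → sum (λ h → ind (B? x ×-dec B? (x · h))))
        ≤⟨ +-mono-≤ (≤-reflexive (*-comm t (card F?))) (sum-mono column) ⟩
      card F? * t + sum (λ x → card B? * ind (B? x))
        ≡⟨ cong (card F? * t +_) (sum-scale (card B?) (ind ∘ B?)) ⟩
      card F? * t + card B? * card B?       ∎
      where
      open ≤-Reasoning
      row : ∀ h → card B? * ind (F? h) ≤ t * ind (F? h) + sum (λ x → ind (B? x ×-dec B? (x · h)))
      row h with F? h
      ... | no _   = ≤-trans (≤-reflexive (*-zeroʳ (card B?))) z≤n
      ... | yes fh = begin
        card B? * 1                                      ≡⟨ *-identityʳ _ ⟩
        card B?                                          ≡⟨ card-split B? (λ x → B? (x · h)) ⟩
        card (λ x → B? x ×-dec B? (x · h)) + gain h      ≡⟨ +-comm _ (gain h) ⟩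
        gain h + card (λ x → B? x ×-dec B? (x · h))      ≤⟨ +-monoˡ-≤ _ (≤-trans (gain≤t h fh) (≤-reflexive (sym (*-identityʳ t)))) ⟩
        t * 1 + card (λ x → B? x ×-dec B? (x · h))       ∎
      column : ∀ x → sum (λ h → ind (B? x ×-dec B? (x · h))) ≤ card B? * ind (B? x)
      column x with B? x
      ... | no ¬bx = ≤-reflexive (trans (card-empty (λ h → no ¬bx ×-dec B? (x · h)) λ h (bx , _) → ¬bx bx) (sym (*-zeroʳ (card B?))))
      ... | yes bx = ≤-trans
        (card-mono (λ h → yes bx ×-dec B? (x · h)) (λ h → B? (x · h)) λ h → proj₂)
        (≤-reflexive (trans (sym (card-·ˡ B? x)) (sym (*-identityʳ _))))


  open Gain

  ∣Π∣-gain : ∀ {μ ν : Multiset} {g} → μ ⊕ δ g ≼ ν → ∣Π μ ∣ + gain (Π? μ) g ≤ ∣Π ν ∣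
  ∣Π∣-gain {μ} {ν} {g} μδ≼ν = subst (λ c → ∣Π μ ∣ + c ≤ ∣Π ν ∣) (sym (card-·ʳ (leaves? (Π? μ) g) (g ⁻¹)))
    (card-disjoint (Π? μ) (λ x → leaves? (Π? μ) g (x · g ⁻¹)) (Π? ν)
      (λ x → Π-mono (λ z → ≤-trans (m≤m+n (μ z) _) (μδ≼ν z)))
      (λ x (p , _) → subst (Π ν) (x·y⁻¹·y x g) (Π-· μδ≼ν p (Π-δ g)))
      (λ x px (_ , ¬q) → ¬q (subst (Π μ) (sym (x·y⁻¹·y x g)) px)))

  -- The left-handed gain |gB ∖ B| = |B ∖ gB|.
  ∣Π∣-gainˡ : ∀ {μ ν : Multiset} {g} → μ ⊕ δ g ≼ ν →
              ∣Π μ ∣ + card (λ x → Π? μ x ×-dec ¬? (Π? μ (g · x))) ≤ ∣Π ν ∣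
  ∣Π∣-gainˡ {μ} {ν} {g} μδ≼ν = subst (λ c → ∣Π μ ∣ + c ≤ ∣Π ν ∣) (sym (card-·ˡ leave? (g ⁻¹)))
    (card-disjoint (Π? μ) (λ x → leave? (g ⁻¹ · x)) (Π? ν)
      (λ x → Π-mono (λ z → ≤-trans (m≤m+n (μ z) _) (μδ≼ν z)))
      (λ x (p , _) → subst (Π ν) (y·y⁻¹·x x g)
         (Π-· (λ z → subst (_≤ ν z) (+-comm (μ z) _) (μδ≼ν z)) (Π-δ g) p))
      (λ x px (_ , ¬q) → ¬q (subst (Π μ) (sym (y·y⁻¹·x x g)) px)))
    where
    leave? : Decidable (λ x → Π μ x × ¬ Π μ (g · x))
    leave? x = Π? μ x ×-dec ¬? (Π? μ (g · x))

  -- Many elements of small gain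

  _⊓ᵐ_ : Multiset → ℕ → Multiset
  (μ ⊓ᵐ j) g = μ g ⊓ j

  _∸ᵐ_ : Multiset → ℕ → Multiset
  (μ ∸ᵐ j) g = μ g ∸ j

  ⊓-suc : ∀ m j → m ⊓ 1 + (m ∸ 1) ⊓ j ≡ m ⊓ suc j
  ⊓-suc zero    j = refl
  ⊓-suc (suc m) j = cong (_+ m ⊓ j) (cong suc (⊓-zeroʳ m))

  ⊓-+ : ∀ m i j → m ⊓ i + (m ∸ i) ⊓ j ≡ m ⊓ (i + j)
  ⊓-+ m       zero    j = cong (_+ m ⊓ j) (⊓-zeroʳ m)
  ⊓-+ zero    (suc i) j = refl
  ⊓-+ (suc m) (suc i) j = cong suc (⊓-+ m i j)

  -- Products with at most one factor from each of the j layers {g : i ≤ μ g}, i = 1, …, j.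
  layers : ∀ {B : Subset} (B? : Decidable B) s j μ → Free μ → (∀ g → 1 ≤ μ g → gain B? g ≤ s) →
    Σ Subset λ F → Σ (Decidable F) λ F? →
      F ε × (∀ h → F h → Π (μ ⊓ᵐ j) h) × (∀ h → F h → gain B? h ≤ j * s) × size (μ ⊓ᵐ j) < card F?
  layers B? s zero μ free gain≤ = (_≡ ε) , (_≟ᶠ ε) , refl ,
    (λ { _ refl → ε∈Π {μ ⊓ᵐ 0} }) ,
    (λ { _ refl → ≤-reflexive (gain-ε B?) }) ,
    ≤-trans (s≤s (≤-reflexive (trans (size-cong {μ ⊓ᵐ 0} {∅} (λ g → ⊓-zeroʳ (μ g))) size-∅))) (card-pos (_≟ᶠ ε) refl)
  layers {B} B? s (suc j) μ free gain≤ with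
    layers B? s j (μ ∸ᵐ 1) (Free-mono (λ g → m∸n≤m (μ g) 1) free) (λ g 1≤ → gain≤ g (≤-trans 1≤ (m∸n≤m (μ g) 1)))
  ... | F , F? , Fε , F⊆Π , F-gain , F-card =
    DF , DF? , (ε , ε , inj₁ refl , Fε , identityʳ ε) ,
    (λ { _ (d , f , Dd , Ff , refl) → Π-· split≼ (D⊆Π d Dd) (F⊆Π f Ff) }) ,
    (λ { _ (d , f , Dd , Ff , refl) → ≤-trans (gain-· B? d f) (+-mono-≤ (D-gain d Dd) (F-gain f Ff)) }) ,
    -- `D` and `F` each exceed the size of their part of μ by one, thanks to ε. Kemperman's bound
    -- loses only one of these two units, so the excess survives.
    ≤-pred (begin
      2 + size (μ ⊓ᵐ suc j)                           ≡⟨ cong (2 +_) (trans (sym (size-cong split≡))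
                                                          (size-⊕ (μ ⊓ᵐ 1) ((μ ∸ᵐ 1) ⊓ᵐ j))) ⟩
      2 + (size (μ ⊓ᵐ 1) + size ((μ ∸ᵐ 1) ⊓ᵐ j))      ≡⟨ cong suc (sym (+-suc (size (μ ⊓ᵐ 1)) _)) ⟩
      suc (size (μ ⊓ᵐ 1)) + suc (size ((μ ∸ᵐ 1) ⊓ᵐ j)) ≤⟨ +-mono-≤ D-card F-card ⟩
      card D? + card F?                               ≤⟨ kemperman D? F? DF? (inj₁ refl) Fε
                                                          (λ d f Dd Ff → Free-Π free split≼μ (D⊆Π d Dd) (F⊆Π f Ff))
                                                          (λ d f Dd Ff → d , f , Dd , Ff , refl) ⟩
      suc (card DF?)                                  ∎)
    where
    open ≤-Reasoning
    split≡ : ∀ g → μ g ⊓ 1 + (μ g ∸ 1) ⊓ j ≡ μ g ⊓ suc j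
    split≡ g = ⊓-suc (μ g) j
    split≼ : (μ ⊓ᵐ 1) ⊕ ((μ ∸ᵐ 1) ⊓ᵐ j) ≼ μ ⊓ᵐ suc j
    split≼ g = ≤-reflexive (split≡ g)
    split≼μ : (μ ⊓ᵐ 1) ⊕ ((μ ∸ᵐ 1) ⊓ᵐ j) ≼ μ
    split≼μ g = ≤-trans (split≼ g) (m⊓n≤m (μ g) (suc j))
    D : Subset
    D x = x ≡ ε ⊎ 1 ≤ μ x
    D? : Decidable D
    D? x = x ≟ᶠ ε ⊎-dec 1 ≤? μ x
    DF : Subset
    DF x = ∃ λ d → ∃ λ f → D d × F f × d · f ≡ x
    DF? : Decidable DF
    DF? x = any? λ d → any? λ f → D? d ×-dec F? f ×-dec (d · f ≟ᶠ x)
    D⊆Π : ∀ d → D d → Π (μ ⊓ᵐ 1) d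
    D⊆Π d (inj₁ refl) = ε∈Π {μ ⊓ᵐ 1}
    D⊆Π d (inj₂ 1≤)   = Π-single {μ ⊓ᵐ 1} (⊓-glb 1≤ ≤-refl)
    D-gain : ∀ d → D d → gain B? d ≤ s
    D-gain d (inj₁ refl) = ≤-trans (≤-reflexive (gain-ε B?)) z≤n
    D-gain d (inj₂ 1≤)   = gain≤ d 1≤
    D-card : suc (size (μ ⊓ᵐ 1)) ≤ card D?
    D-card = ≤-trans (+-mono-≤ (card-pos (_≟ᶠ ε) refl) (sum-mono λ g → ⊓≤ind (μ g)))
      (card-disjoint (_≟ᶠ ε) (λ x → 1 ≤? μ x) D? (λ _ → inj₁) (λ _ → inj₂)
        (λ x x≡ε 1≤ → Free-g≢ε free 1≤ x≡ε))
      where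
      ⊓≤ind : ∀ m → m ⊓ 1 ≤ ind (1 ≤? m)
      ⊓≤ind m with 1 ≤? m
      ... | yes _  = m⊓n≤n m 1
      ... | no 1≰m = ≤-trans (m⊓n≤m m 1) (≤-pred (≰⇒> 1≰m))

  -- Each h from the first family and each h⁻¹ from the second costs at most j gains,
  -- so the two families together double the number of elements of small gain.
  many-small-gains : ∀ {B : Subset} (B? : Decidable B) s j ρ → Free ρ → (∀ g → 1 ≤ ρ g → gain B? g ≤ s) →
    Σ Subset λ F → Σ (Decidable F) λ F? → (∀ h → F h → gain B? h ≤ j * s) × size (ρ ⊓ᵐ (j + j)) ≤ card F?
  many-small-gains B? s j ρ free gain≤
    with layers B? s j ρ free gain≤
       | layers B? s j (ρ ∸ᵐ j) (Free-mono (λ g → m∸n≤m (ρ g) j) free)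
           (λ g 1≤ → gain≤ g (≤-trans 1≤ (m∸n≤m (ρ g) j)))
  ... | F₁ , F₁? , _ , F₁⊆Π , F₁-gain , F₁-card | F₂ , F₂? , _ , F₂⊆Π , F₂-gain , F₂-card =
    (λ x → F₁ x ⊎ F₂ (x ⁻¹)) , F? ,
    (λ { h (inj₁ f) → F₁-gain h f
       ; h (inj₂ f) → subst (_≤ j * s) (gain-⁻¹ B? h) (F₂-gain (h ⁻¹) f) }) ,
    ≤-pred (begin
      suc (size (ρ ⊓ᵐ (j + j)))                          ≡⟨ cong suc (trans (sym (size-cong λ g → ⊓-+ (ρ g) j j))
                                                             (size-⊕ (ρ ⊓ᵐ j) ((ρ ∸ᵐ j) ⊓ᵐ j))) ⟩
      suc (size (ρ ⊓ᵐ j) + size ((ρ ∸ᵐ j) ⊓ᵐ j))         ≤⟨ ≤-trans (n≤1+n _)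
                                                             (≤-reflexive (cong suc (sym (+-suc (size (ρ ⊓ᵐ j)) _)))) ⟩
      suc (size (ρ ⊓ᵐ j)) + suc (size ((ρ ∸ᵐ j) ⊓ᵐ j))   ≤⟨ +-mono-≤ F₁-card F₂-card ⟩
      card F₁? + card F₂?                                ≡⟨ cong (card F₁? +_) (card-⁻¹ F₂?) ⟩
      card F₁? + card (λ x → F₂? (x ⁻¹))                 ≤⟨ +-monoʳ-≤ (card F₁?) F₂≤ ⟩
      card F₁? + suc (card F₂∖ε?)                        ≡⟨ +-suc (card F₁?) _ ⟩
      -- If x lies in the first family and x⁻¹ in the second, they are products over disjoint parts
      -- of ρ, so freeness forces x = ε.
      suc (card F₁? + card F₂∖ε?)                        ≤⟨ s≤s (card-disjoint F₁? F₂∖ε? F? (λ _ → inj₁) (λ _ → inj₂ ∘ proj₁)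
                                                              λ x f₁ (f₂ , x≢ε) → x≢ε (Free-Π free split≼
                                                                (F₁⊆Π x f₁) (F₂⊆Π (x ⁻¹) f₂) (inverseʳ x))) ⟩
      suc (card F?)                                      ∎)
    where
    open ≤-Reasoning
    F? : Decidable (λ x → F₁ x ⊎ F₂ (x ⁻¹))
    F? x = F₁? x ⊎-dec F₂? (x ⁻¹)
    F₂∖ε? : Decidable (λ x → F₂ (x ⁻¹) × ¬ (x ≡ ε))
    F₂∖ε? x = F₂? (x ⁻¹) ×-dec ¬? (x ≟ᶠ ε)
    F₂≤ : card (λ x → F₂? (x ⁻¹)) ≤ suc (card F₂∖ε?)
    F₂≤ = ≤-trans (card-cover (_≟ᶠ ε) F₂∖ε? (λ x → F₂? (x ⁻¹)) λ x f → case x f (x ≟ᶠ ε))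
      (+-monoˡ-≤ (card F₂∖ε?) (card-subsingleton (_≟ᶠ ε) λ x y x≡ y≡ → trans x≡ (sym y≡)))
      where
      case : ∀ x → F₂ (x ⁻¹) → Dec (x ≡ ε) → x ≡ ε ⊎ (F₂ (x ⁻¹) × ¬ (x ≡ ε))
      case x f (yes x≡ε) = inj₁ x≡ε
      case x f (no x≢ε)  = inj₂ (f , x≢ε)
    split≼ : (ρ ⊓ᵐ j) ⊕ ((ρ ∸ᵐ j) ⊓ᵐ j) ≼ ρ
    split≼ g = ≤-trans (≤-reflexive (⊓-+ (ρ g) j j)) (m⊓n≤m (ρ g) (j + j))

  -- Numerical estimates for the growth of Π V

  -- Here t - x = r - s lies between -s and s, and (x + t)² = 4xt + (t - x)².
  near-square : ∀ {x t s r} → t + s ≡ r + x → r < s + s → (x + t) * (x + t) ≤ 4 * (x * t) + s * s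
  near-square {x} {t} {s} {r} eq r<2s with ≤-total x t
  ... | inj₁ x≤t with m≤n⇒∃[o]m+o≡n x≤t
  ...   | e , refl = ≤-trans (≤-reflexive (expand x e)) (+-monoʳ-≤ (4 * (x * (x + e))) (*-mono-≤ e≤s e≤s))
    where
    expand : ∀ x e → (x + (x + e)) * (x + (x + e)) ≡ 4 * (x * (x + e)) + e * e
    expand = solve-∀
    e+s≡r : e + s ≡ r
    e+s≡r = +-cancelˡ-≡ x _ _ (trans (sym (+-assoc x e s)) (trans eq (+-comm r x)))
    e≤s : e ≤ s
    e≤s = +-cancelʳ-≤ s e s (<⇒≤ (subst (_< s + s) (sym e+s≡r) r<2s))
  near-square {x} {t} {s} {r} eq r<2s | inj₂ t≤x with m≤n⇒∃[o]m+o≡n t≤x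
  ...   | e , refl = ≤-trans (≤-reflexive (expand t e)) (+-monoʳ-≤ (4 * ((t + e) * t)) (*-mono-≤ e≤s e≤s))
    where
    expand : ∀ t e → (t + e + t) * (t + e + t) ≡ 4 * ((t + e) * t) + e * e
    expand = solve-∀
    comm : ∀ r t e → r + (t + e) ≡ t + (e + r)
    comm = solve-∀
    e≤s : e ≤ s
    e≤s = ≤-trans (m≤m+n e r) (≤-reflexive (sym (+-cancelˡ-≡ t _ _ (trans eq (comm r t e)))))

  -- Cutting a multiplicity x ≤ 2m at 2j keeps at least the fraction j/m of it.
  size-⊓ : ∀ {m j} (ρ : Multiset) → (∀ g → ρ g ≤ m + m) → j ≤ m → j * size ρ ≤ m * size (ρ ⊓ᵐ (j + j))
  size-⊓ {m} {j} ρ ρ≤2m j≤m = begin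
    j * size ρ                        ≡⟨ sym (sum-scale j ρ) ⟩
    sum (λ g → j * ρ g)               ≤⟨ sum-mono (λ g → pointwise (ρ g) (ρ≤2m g) (≤-total (ρ g) (j + j))) ⟩
    sum (λ g → m * (ρ g ⊓ (j + j)))   ≡⟨ sum-scale m (ρ ⊓ᵐ (j + j)) ⟩
    m * size (ρ ⊓ᵐ (j + j))           ∎
    where
    open ≤-Reasoning
    exchange : ∀ m j → j * (m + m) ≡ m * (j + j)
    exchange = solve-∀
    pointwise : ∀ x → x ≤ m + m → x ≤ j + j ⊎ j + j ≤ x → j * x ≤ m * (x ⊓ (j + j))
    pointwise x x≤2m (inj₁ x≤2j) = begin
      j * x               ≤⟨ *-monoˡ-≤ x j≤m ⟩
      m * x               ≡⟨ cong (m *_) (sym (m≤n⇒m⊓n≡m x≤2j)) ⟩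
      m * (x ⊓ (j + j))   ∎
    pointwise x x≤2m (inj₂ 2j≤x) = begin
      j * x               ≤⟨ *-monoʳ-≤ j x≤2m ⟩
      j * (m + m)         ≡⟨ exchange m j ⟩
      m * (j + j)         ≡⟨ cong (m *_) (sym (m≥n⇒m⊓n≡n 2j≤x)) ⟩
      m * (x ⊓ (j + j))   ∎

  -- Division by a² and s/a ≤ 1/k turn the hypothesis into q ≤ 4s + q/k².
  scaled-bound : ∀ {q a s} k → 1 ≤ a → k * s ≤ a → q * (a * a) ≤ 4 * s * (a * a) + q * (s * s) →
    k * k * q ≤ k * k * (4 * s) + q
  scaled-bound {q} {suc a′} {s} k 1≤a ks≤a upper = *-cancelʳ-≤ (k * k * q) _ (a * a) (begin
    k * k * q * (a * a)                              ≡⟨ *-assoc (k * k) q (a * a) ⟩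
    k * k * (q * (a * a))                            ≤⟨ *-monoʳ-≤ (k * k) upper ⟩
    k * k * (4 * s * (a * a) + q * (s * s))          ≡⟨ rearrange k s q (a * a) ⟩
    k * k * (4 * s) * (a * a) + q * (k * s * (k * s)) ≤⟨ +-monoʳ-≤ (k * k * (4 * s) * (a * a)) (*-monoʳ-≤ q (*-mono-≤ ks≤a ks≤a)) ⟩
    k * k * (4 * s) * (a * a) + q * (a * a)          ≡⟨ sym (*-distribʳ-+ (a * a) (k * k * (4 * s)) q) ⟩
    (k * k * (4 * s) + q) * (a * a)                  ∎)
    where
    open ≤-Reasoning
    a = suc a′
    rearrange : ∀ k s q c → k * k * (4 * s * c + q * (s * s)) ≡ k * k * (4 * s) * c + q * (k * s * (k * s))
    rearrange = solve-∀

  -- Write q = 9m + 4. If s ≤ 4, then a ≥ 2s gives 3q ≤ 16s, but 16s ≤ 26m + 12 < 3q. If s ≥ 5, then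
  -- a ≥ 3s gives 8q ≤ 36s, but 36s ≤ 72m < 8q. The second case asks for the 9m; the first, at m = 2
  -- and s = 4, asks for the 4, since there 3q = 66 only just exceeds 64.
  quadratic-bound : ∀ {m s a} → 1 ≤ m → 1 ≤ s → s ≤ m + m → 2 + s * suc s ≤ 2 * a →
    (9 * m + 4) * (a * a) ≤ 4 * s * (a * a) + (9 * m + 4) * (s * s) → ⊥
  quadratic-bound {m} {s} {a} 1≤m 1≤s s≤2m lower upper with s ≤? 4
  ... | yes s≤4 = <⇒≱ 16s<3q (scaled-bound {9 * m + 4} {a} {s} 2 1≤a (small s s≤4 1≤s lower) upper)
    where
    open ≤-Reasoning
    1≤a : 1 ≤ a
    1≤a = *-cancelˡ-≤ 2 (≤-trans (m≤m+n 2 (s * suc s)) lower)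
    small : ∀ s → s ≤ 4 → 1 ≤ s → 2 + s * suc s ≤ 2 * a → 2 * s ≤ a
    small 1 _ _ l = *-cancelˡ-≤ 2 l
    small 2 _ _ l = *-cancelˡ-≤ 2 l
    small 3 _ _ l = *-cancelˡ-≤ 2 (≤-trans (m≤n+m 12 2) l)
    small 4 _ _ l = *-cancelˡ-≤ 2 (≤-trans (m≤n+m 16 6) l)
    small (suc (suc (suc (suc (suc _))))) (s≤s (s≤s (s≤s (s≤s ())))) _ _
    16s≡ : ∀ s m → 4 * (4 * s) + (9 * m + 4) ≡ 13 * s + 3 * s + (9 * m + 4)
    16s≡ = solve-∀
    3q≡ : ∀ m → 4 * (9 * m + 4) ≡ m + (13 * (m + m) + 3 * 4 + (9 * m + 4))
    3q≡ = solve-∀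
    16s<3q : 4 * (4 * s) + (9 * m + 4) < 4 * (9 * m + 4)
    16s<3q = begin-strict
      4 * (4 * s) + (9 * m + 4)                     ≡⟨ 16s≡ s m ⟩
      13 * s + 3 * s + (9 * m + 4)                  ≤⟨ +-monoˡ-≤ (9 * m + 4) (+-mono-≤ (*-monoʳ-≤ 13 s≤2m) (*-monoʳ-≤ 3 s≤4)) ⟩
      13 * (m + m) + 3 * 4 + (9 * m + 4)            <⟨ m<n+m _ 1≤m ⟩
      m + (13 * (m + m) + 3 * 4 + (9 * m + 4))      ≡⟨ sym (3q≡ m) ⟩
      4 * (9 * m + 4)                               ∎
  ... | no s≰4 = <⇒≱ 36s<8q (scaled-bound {9 * m + 4} {a} {s} 3 1≤a 3s≤a upper)
    where
    open ≤-Reasoning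
    1≤a : 1 ≤ a
    1≤a = *-cancelˡ-≤ 2 (≤-trans (m≤m+n 2 (s * suc s)) lower)
    3s≤a : 3 * s ≤ a
    3s≤a = *-cancelˡ-≤ 2 (begin
      2 * (3 * s)     ≡⟨ trans (sym (*-assoc 2 3 s)) (*-comm 6 s) ⟩
      s * 6           ≤⟨ *-monoʳ-≤ s (s≤s (≰⇒> s≰4)) ⟩
      s * suc s       ≤⟨ m≤n+m _ 2 ⟩
      2 + s * suc s   ≤⟨ lower ⟩
      2 * a           ∎)
    8q≡ : ∀ m → 9 * (9 * m + 4) ≡ 9 * (4 * (m + m)) + (9 * m + 4) + 32
    8q≡ = solve-∀
    36s<8q : 9 * (4 * s) + (9 * m + 4) < 9 * (9 * m + 4)
    36s<8q = begin-strict
      9 * (4 * s) + (9 * m + 4)                 ≤⟨ +-monoˡ-≤ (9 * m + 4) (*-monoʳ-≤ 9 (*-monoʳ-≤ 4 s≤2m)) ⟩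
      9 * (4 * (m + m)) + (9 * m + 4)           <⟨ m<m+n _ (s≤s z≤n) ⟩
      9 * (4 * (m + m)) + (9 * m + 4) + 32      ≡⟨ sym (8q≡ m) ⟩
      9 * (9 * m + 4)                           ∎

  -- Construction of a dense subsequence

  -- Let a = |B| and q = 9m + 4, and suppose that all gains are at most s. For j ≤ m there are at
  -- least jq elements of gain at most js. Averaging over them gives jq(a - js) ≤ a². For js close
  -- to a/2 this makes qa² at most 4sa² + qs², against `quadratic-bound`.
  growth-step : ∀ {B : Subset} (B? : Decidable B) {m s} ρ → Free ρ → 1 ≤ m → 1 ≤ s → s ≤ m + m →
    (∀ g → ρ g ≤ m + m) → (9 * m + 4) * m < size ρ →
    2 + s * suc s ≤ 2 * card B? → card B? ≤ suc m * s → ∃ λ g → 1 ≤ ρ g × s < gain B? g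
  growth-step B? {m} {s} ρ free 1≤m 1≤s s≤2m ρ≤2m large lower upper
    with any? (λ g → 1 ≤? ρ g ×-dec s <? gain B? g)
  ... | yes found = found
  ... | no ¬found = ⊥-elim (quadratic-bound {m} {s} {card B?} 1≤m 1≤s s≤2m lower final)
    where
    open ≤-Reasoning
    instance
      s≢0 : NonZero (s + s)
      s≢0 = >-nonZero (≤-trans 1≤s (m≤m+n s s))
      m≢0 : NonZero m
      m≢0 = >-nonZero 1≤m
    a q j r t : ℕ
    a = card B?
    q = 9 * m + 4
    -- The integer nearest to a/(2s): it brings js within s/2 of a/2, so js and t = a - js differ by
    -- at most s, as `near-square` requires.
    j = (a + s) / (s + s)
    r = (a + s) % (s + s)
    t = a ∸ j * s
    division : a + s ≡ r + j * (s + s)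
    division = m≡m%n+[m/n]*n (a + s) (s + s)
    js≤a : j * s ≤ a
    js≤a with j | division
    ... | zero   | _  = z≤n
    ... | suc j′ | eq = +-cancelʳ-≤ s _ _ (begin
      suc j′ * s + s            ≤⟨ +-monoʳ-≤ (suc j′ * s) (m≤m+n s (j′ * s)) ⟩
      suc j′ * s + suc j′ * s   ≡⟨ sym (*-distribˡ-+ (suc j′) s s) ⟩
      suc j′ * (s + s)          ≤⟨ m≤n+m _ r ⟩
      r + suc j′ * (s + s)      ≡⟨ sym eq ⟩
      a + s                     ∎)
    a≡ : j * s + t ≡ a
    a≡ = m+[n∸m]≡n js≤a
    t+s≡ : t + s ≡ r + j * s
    t+s≡ = +-cancelˡ-≡ (j * s) _ _ (begin-equality
      j * s + (t + s)        ≡⟨ sym (+-assoc (j * s) t s) ⟩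
      j * s + t + s          ≡⟨ cong (_+ s) a≡ ⟩
      a + s                  ≡⟨ division ⟩
      r + j * (s + s)        ≡⟨ spread r j s ⟩
      j * s + (r + j * s)    ∎)
      where
      spread : ∀ r j s → r + j * (s + s) ≡ j * s + (r + j * s)
      spread = solve-∀
    a²≤ : a * a ≤ 4 * (j * s * t) + s * s
    a²≤ = subst (λ c → c * c ≤ 4 * (j * s * t) + s * s) a≡ (near-square {j * s} {t} t+s≡ (m%n<n (a + s) (s + s)))
    -- From a ≤ (m + 1)s: if j ≥ m + 1, then 2(m + 1)s ≤ j · 2s ≤ a + s ≤ (m + 2)s, which is
    -- impossible for m ≥ 1.
    j≤m : j ≤ m
    j≤m = ≮⇒≥ λ m<j → <⇒≱ (tooLarge m<j) (≤-refl {a + s})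
      where
      reassoc : ∀ m s → suc m * (s + s) ≡ m * s + (suc m * s + s)
      reassoc = solve-∀
      tooLarge : m < j → a + s < a + s
      tooLarge m<j = begin-strict
        a + s                        ≤⟨ +-monoˡ-≤ s upper ⟩
        suc m * s + s                <⟨ m<n+m _ (*-mono-≤ 1≤m 1≤s) ⟩
        m * s + (suc m * s + s)      ≡⟨ sym (reassoc m s) ⟩
        suc m * (s + s)              ≤⟨ *-monoˡ-≤ (s + s) m<j ⟩
        j * (s + s)                  ≤⟨ m≤n+m _ r ⟩
        r + j * (s + s)              ≡⟨ sym division ⟩
        a + s                        ∎
    smallGain : ∀ g → 1 ≤ ρ g → gain B? g ≤ s
    smallGain g 1≤ = ≮⇒≥ λ s< → ¬found (g , 1≤ , s<)
    family = many-small-gains B? s j ρ free smallGain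
    F? = proj₁ (proj₂ family)
    f : ℕ
    f = card F?
    ft≤a² : f * t ≤ a * a
    ft≤a² = +-cancelˡ-≤ (f * (j * s)) _ _ (begin
      f * (j * s) + f * t      ≡⟨ sym (*-distribˡ-+ f (j * s) t) ⟩
      f * (j * s + t)          ≡⟨ cong (f *_) a≡ ⟩
      f * a                    ≤⟨ gain-average B? F? (j * s) (proj₁ (proj₂ (proj₂ family))) ⟩
      f * (j * s) + a * a      ∎)
    jq≤f : j * q ≤ f
    jq≤f = ≤-trans (*-cancelˡ-≤ m (begin
      m * (j * q)                   ≡⟨ rotate m j q ⟩
      j * (q * m)                   ≤⟨ *-monoʳ-≤ j (<⇒≤ large) ⟩
      j * size ρ                    ≤⟨ size-⊓ ρ ρ≤2m j≤m ⟩
      m * size (ρ ⊓ᵐ (j + j))       ∎)) (proj₂ (proj₂ (proj₂ family)))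
      where
      rotate : ∀ m j q → m * (j * q) ≡ j * (q * m)
      rotate = solve-∀
    final : q * (a * a) ≤ 4 * s * (a * a) + q * (s * s)
    final = begin
      q * (a * a)                            ≤⟨ *-monoʳ-≤ q a²≤ ⟩
      q * (4 * (j * s * t) + s * s)          ≡⟨ rotate q j s t ⟩
      4 * s * (j * q * t) + q * (s * s)      ≤⟨ +-monoˡ-≤ (q * (s * s)) (*-monoʳ-≤ (4 * s) (≤-trans (*-monoˡ-≤ t jq≤f) ft≤a²)) ⟩
      4 * s * (a * a) + q * (s * s)          ∎
      where
      rotate : ∀ q j s t → q * (4 * (j * s * t) + s * s) ≡ 4 * s * (j * q * t) + q * (s * s)
      rotate = solve-∀

  Dense : ℕ → Multiset → Set
  Dense p ρ = ∃ λ V → V ≼ ρ × 1 ≤ size V × p * size V < ∣Π V ∣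

  -- While V with s terms is not dense, `growth-step` supplies a term that adds at least s + 1
  -- products. So |Π V| grows at least like 1 + (1 + 2 + ... + s), and at s = 2m + 1 this triangular
  -- bound is 1 + ps.
  dense-subsequence : ∀ {m} → 1 ≤ m → ∀ ρ → Free ρ → (∀ g → ρ g ≤ m + m) → (9 * m + 6) * m < size ρ →
    Dense (suc m) ρ
  dense-subsequence {m} 1≤m ρ free ρ≤2m large = conclude (grow (suc (m + m)) ≤-refl)
    where
    open ≤-Reasoning
    Stage : ℕ → Set
    Stage s = ∃ λ V → V ≼ ρ × size V ≡ s × 2 + s * suc s ≤ 2 * ∣Π V ∣

    extend : ∀ {V s g} → V ≼ ρ → size V ≡ s → 1 ≤ (ρ ⊖ V) g → 2 + s * suc s ≤ 2 * ∣Π V ∣ →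
             suc s + ∣Π V ∣ ≤ ∣Π V ⊕ δ g ∣ → Stage (suc s)
    extend {V} {s} {g} V≼ρ size≡ 1≤ lower big = V ⊕ δ g ,
      (λ x → ≤-trans (+-monoʳ-≤ (V x) (δ≼ {ρ ⊖ V} 1≤ x)) (≤-reflexive (m+[n∸m]≡n (V≼ρ x)))) ,
      trans (size-⊕ V (δ g)) (trans (cong₂ _+_ size≡ (size-δ g)) (+-comm s 1)) , (begin
      2 + suc s * suc (suc s)        ≡⟨ next s ⟩
      2 * suc s + (2 + s * suc s)    ≤⟨ +-monoʳ-≤ (2 * suc s) lower ⟩
      2 * suc s + 2 * ∣Π V ∣         ≡⟨ sym (*-distribˡ-+ 2 (suc s) ∣Π V ∣) ⟩
      2 * (suc s + ∣Π V ∣)           ≤⟨ *-monoʳ-≤ 2 big ⟩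
      2 * ∣Π V ⊕ δ g ∣               ∎)
      where
      next : ∀ s → 2 + suc s * suc (suc s) ≡ 2 * suc s + (2 + s * suc s)
      next = solve-∀

    grow : ∀ s → s ≤ suc (m + m) → Dense (suc m) ρ ⊎ Stage s
    grow zero _ = inj₂ (∅ , (λ _ → z≤n) , size-∅ , *-monoʳ-≤ 2 (card-pos (Π? ∅) (ε∈Π {∅})))
    grow (suc s) s<  with grow s (<⇒≤ s<)
    ... | inj₁ dense = inj₁ dense
    -- `growth-step` starts at s = 1. For the first term it is enough that it differs from ε and so
    -- adds one product.
    grow (suc zero) s< | inj₂ (V , V≼ρ , size≡ , lower) =
      let g , 1≤ = sum-pos (ρ ⊖ V) (+-cancelˡ-≤ (size V) 1 (size (ρ ⊖ V)) (begin
                     size V + 1               ≡⟨ cong (_+ 1) size≡ ⟩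
                     1                        ≤⟨ ≤-trans (s≤s z≤n) large ⟩
                     size ρ                   ≡⟨ size-⊖ V≼ρ ⟩
                     size V + size (ρ ⊖ V)    ∎))
          Vδ≼ρ : V ⊕ δ g ≼ ρ
          Vδ≼ρ x = ≤-trans (+-monoʳ-≤ (V x) (δ≼ {ρ ⊖ V} 1≤ x)) (≤-reflexive (m+[n∸m]≡n (V≼ρ x)))
      in inj₂ (extend V≼ρ size≡ 1≤ lower
           (∣Π∣-suc {V} {V ⊕ δ g} (Free-mono Vδ≼ρ free)
             (Free-g≢ε free (≤-trans 1≤ (m∸n≤m (ρ g) (V g)))) (λ _ → ≤-refl)))
    grow (suc s@(suc _)) s< | inj₂ (V , V≼ρ , size≡ , lower) with suc m * s <? ∣Π V ∣
    ... | yes dense = inj₁ (V , V≼ρ , subst (1 ≤_) (sym size≡) (s≤s z≤n) , subst (λ k → suc m * k < ∣Π V ∣) (sym size≡) dense)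
    ... | no ¬dense =
      let g , 1≤ , s<gain = growth-step (Π? V) (ρ ⊖ V) (Free-mono (λ x → m∸n≤m (ρ x) (V x)) free) 1≤m (s≤s z≤n)
            (≤-pred s<) (λ x → ≤-trans (m∸n≤m (ρ x) (V x)) (ρ≤2m x)) large′ lower (≮⇒≥ ¬dense)
      in inj₂ (extend V≼ρ size≡ 1≤ lower (begin
           suc s + ∣Π V ∣               ≡⟨ +-comm (suc s) ∣Π V ∣ ⟩
           ∣Π V ∣ + suc s               ≤⟨ +-monoʳ-≤ ∣Π V ∣ s<gain ⟩
           ∣Π V ∣ + gain (Π? V) g       ≤⟨ ∣Π∣-gain {V} {V ⊕ δ g} (λ _ → ≤-refl) ⟩
           ∣Π V ⊕ δ g ∣                 ∎))
      where
      expand : ∀ m → (9 * m + 6) * m ≡ (m + m) + (9 * m + 4) * m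
      expand = solve-∀
      -- The passage from 9m + 4 to 9m + 6 pays for the at most 2m terms already moved to V.
      large′ : (9 * m + 4) * m < size (ρ ⊖ V)
      large′ = +-cancelˡ-< (m + m) _ _ (begin-strict
        (m + m) + (9 * m + 4) * m   ≡⟨ sym (expand m) ⟩
        (9 * m + 6) * m             <⟨ large ⟩
        size ρ                      ≡⟨ trans (size-⊖ V≼ρ) (cong (_+ size (ρ ⊖ V)) size≡) ⟩
        s + size (ρ ⊖ V)            ≤⟨ +-monoˡ-≤ (size (ρ ⊖ V)) (≤-pred s<) ⟩
        (m + m) + size (ρ ⊖ V)      ∎)

    conclude : Dense (suc m) ρ ⊎ Stage (suc (m + m)) → Dense (suc m) ρ
    conclude (inj₁ dense) = dense
    conclude (inj₂ (V , V≼ρ , size≡ , lower)) = V , V≼ρ , subst (1 ≤_) (sym size≡) (s≤s z≤n) ,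
      *-cancelˡ-≤ 2 (≤-trans (≤-reflexive (trans (cong (λ k → 2 * suc (suc m * k)) size≡) (double m))) lower)
      where
      double : ∀ m → 2 * suc (suc m * suc (m + m)) ≡ 2 + suc (m + m) * suc (suc (m + m))
      double = solve-∀

  -- Powers, orders and Lagrange's theorem for cyclic subgroups

  pw : Fin n → ℕ → Fin n
  pw = pow G

  pow-+ : ∀ g a b → pw g (a + b) ≡ pw g a · pw g b
  pow-+ g zero    b = sym (identityˡ _)
  pow-+ g (suc a) b = trans (cong (g ·_) (pow-+ g a b)) (sym (assoc g _ _))

  pow-* : ∀ g a b → pw g (a * b) ≡ pw (pw g b) a
  pow-* g zero    b = refl
  pow-* g (suc a) b = trans (pow-+ g b (a * b)) (cong (pw g b ·_) (pow-* g a b))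

  pow-ε : ∀ k → pw ε k ≡ ε
  pow-ε zero    = refl
  pow-ε (suc k) = trans (identityˡ _) (pow-ε k)

  pow-suc : ∀ g k → pw g (suc k) ≡ pw g k · g
  pow-suc g k = trans (cong (pw g) (+-comm 1 k)) (trans (pow-+ g k 1) (cong (pw g k ·_) (identityʳ g)))

  private instance
    n≢0 : NonZero n
    n≢0 = nonZeroIndex ε

  gap : ∀ {y i j} → i < j → pw y i ≡ pw y j → pw y (j ∸ i) ≡ ε
  gap {y} {i} {j} i<j eq = ∙-cancelˡ (pw y i) _ _ (trans (sym (pow-+ y i (j ∸ i)))
    (trans (cong (pw y) (m+[n∸m]≡n (<⇒≤ i<j))) (trans (sym eq) (sym (identityʳ _)))))

  order : ∀ y → ∃ λ m → 0 < m × pw y m ≡ ε × (∀ {k} → 0 < k → k < m → pw y k ≢ ε)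
  order y with pigeonhole ≤-refl (λ (k : Fin (suc n)) → pw y (toℕ k))
  ... | i , j , i<j , eq with search (toℕ j ∸ toℕ i)
    where
    search : ∀ b → (∃ λ m → 0 < m × pw y m ≡ ε × (∀ {k} → 0 < k → k < m → pw y k ≢ ε)) ⊎
                   (∀ {k} → 0 < k → k ≤ b → pw y k ≢ ε)
    search zero    = inj₂ λ 0<k k≤0 → contradiction (≤-trans 0<k k≤0) λ()
    search (suc b) with search b
    ... | inj₁ found = inj₁ found
    ... | inj₂ none with pw y (suc b) ≟ᶠ ε
    ...   | yes y^b≡ε = inj₁ (suc b , s≤s z≤n , y^b≡ε , λ 0<k k< → none 0<k (≤-pred k<))
    ...   | no  y^b≢ε = inj₂ λ 0<k k≤ → [ (λ k< → none 0<k (≤-pred k<)) , (λ { refl → y^b≢ε }) ] (m≤n⇒m<n∨m≡n k≤)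
  ...   | inj₁ found = found
  ...   | inj₂ none  = contradiction (gap {y} {toℕ i} {toℕ j} i<j eq) (none (m<n⇒0<n∸m i<j) ≤-refl)

  card-image : ∀ {k} (f : Fin k → Fin n) → card (λ x → any? λ i → x ≟ᶠ f i) ≤ k
  card-image {zero}  f = ≤-reflexive (card-empty (λ x → any? λ i → x ≟ᶠ f i) λ { _ (() , _) })
  card-image {suc k} f = ≤-trans
    (card-cover (_≟ᶠ f zero) (λ x → any? λ i → x ≟ᶠ f (suc i)) (λ x → any? λ i → x ≟ᶠ f i)
      λ { x (zero , eq) → inj₁ eq ; x (suc i , eq) → inj₂ (i , eq) })
    (+-mono-≤ (card-subsingleton (_≟ᶠ f zero) λ x y x≡ y≡ → trans x≡ (sym y≡)) (card-image (f ∘ suc)))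

  module Lagrange (y : Fin n) where

    m : ℕ
    m = proj₁ (order y)

    0<m : 0 < m
    0<m = proj₁ (proj₂ (order y))

    y^m≡ε : pw y m ≡ ε
    y^m≡ε = proj₁ (proj₂ (proj₂ (order y)))

    private instance
      m≢0 : NonZero m
      m≢0 = >-nonZero 0<m

    pow-% : ∀ k → pw y k ≡ pw y (k % m)
    pow-% k = begin
      pw y k                              ≡⟨ cong (pw y) (m≡m%n+[m/n]*n k m) ⟩
      pw y (k % m + k / m * m)            ≡⟨ pow-+ y (k % m) (k / m * m) ⟩
      pw y (k % m) · pw y (k / m * m)     ≡⟨ cong (pw y (k % m) ·_) (pow-* y (k / m) m) ⟩
      pw y (k % m) · pw (pw y m) (k / m)  ≡⟨ cong (λ z → pw y (k % m) · pw z (k / m)) y^m≡ε ⟩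
      pw y (k % m) · pw ε (k / m)         ≡⟨ cong (pw y (k % m) ·_) (pow-ε (k / m)) ⟩
      pw y (k % m) · ε                    ≡⟨ identityʳ _ ⟩
      pw y (k % m)                        ∎
      where open ≡-Reasoning

    Orbit : Fin n → Subset
    Orbit x z = ∃ λ (i : Fin m) → z ≡ x · pw y (toℕ i)

    Orbit? : ∀ x → Decidable (Orbit x)
    Orbit? x z = any? λ i → z ≟ᶠ x · pw y (toℕ i)

    orbit : ∀ x k → Orbit x (x · pw y k)
    orbit x k = fromℕ< (m%n<n k m) , cong (x ·_) (trans (pow-% k) (cong (pw y) (sym (toℕ-fromℕ< (m%n<n k m)))))

    orbit-back : ∀ {x z} → Orbit x (z · y) → Orbit x z
    orbit-back {x} {z} (i , eq) = subst (Orbit x) (begin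
      x · pw y (toℕ i + (m ∸ 1))          ≡⟨ cong (x ·_) (pow-+ y (toℕ i) (m ∸ 1)) ⟩
      x · (pw y (toℕ i) · pw y (m ∸ 1))   ≡⟨ sym (assoc x _ _) ⟩
      x · pw y (toℕ i) · pw y (m ∸ 1)     ≡⟨ cong (_· pw y (m ∸ 1)) (sym eq) ⟩
      z · y · pw y (m ∸ 1)                ≡⟨ assoc z y _ ⟩
      z · pw y (suc (m ∸ 1))              ≡⟨ cong (λ k → z · pw y k) (m+[n∸m]≡n 0<m) ⟩
      z · pw y m                          ≡⟨ cong (z ·_) y^m≡ε ⟩
      z · ε                               ≡⟨ identityʳ z ⟩
      z                                   ∎) (orbit x (toℕ i + (m ∸ 1)))
      where open ≡-Reasoning

    no-gap : ∀ {i j} → i < j → j < m → pw y (j ∸ i) ≢ ε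
    no-gap {i} {j} i<j j<m = proj₂ (proj₂ (proj₂ (order y))) (m<n⇒0<n∸m i<j) (≤-<-trans (m∸n≤m j i) j<m)

    pow-injective : ∀ {i j} → i < m → j < m → pw y i ≡ pw y j → i ≡ j
    pow-injective {i} {j} i<m j<m eq with <-cmp i j
    ... | tri< i<j _ _ = contradiction (gap i<j eq) (no-gap i<j j<m)
    ... | tri≈ _ i≡j _ = i≡j
    ... | tri> _ _ j<i = contradiction (gap j<i (sym eq)) (no-gap j<i i<m)

    card-orbit : ∀ x → card (Orbit? x) ≡ m
    card-orbit x = ≤-antisym (card-image (λ i → x · pw y (toℕ i)))
      (card-injection (Orbit? x) (λ i → x · pw y (toℕ i)) (λ i → i , refl)
        (λ i j eq → toℕ-injective (pow-injective (toℕ<n i) (toℕ<n j) (∙-cancelˡ x _ _ eq))))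

    -- A set closed under right multiplication by y is a disjoint union of orbits of size `m`. One
    -- orbit is removed at a time, with `k` bounding what is left; the whole group then gives m ∣ n.
    closed⇒m∣card : ∀ k {P : Subset} (P? : Decidable P) → (∀ x → P x → P (x · y)) → card P? ≤ k → m ∣ card P?
    closed⇒m∣card k P? closed ≤k with card P? in eq
    ... | zero = m ∣0
    closed⇒m∣card (suc k) {P} P? closed ≤k | suc c = subst (m ∣_) (trans (sym (card-split P? (Orbit? x))) eq)
      (∣m∣n⇒∣m+n (subst (m ∣_) (sym inside≡m) n∣n) (closed⇒m∣card k outside? outside-closed outside≤k))
      where
      found = card-inhabited P? (subst (1 ≤_) (sym eq) (s≤s z≤n))
      x = proj₁ found
      closed-pow : ∀ i → P (x · pw y i)
      closed-pow zero    = subst P (sym (identityʳ x)) (proj₂ found)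
      closed-pow (suc i) = subst P (trans (assoc x _ y) (cong (x ·_) (sym (pow-suc y i)))) (closed _ (closed-pow i))
      inside? : Decidable (λ z → P z × Orbit x z)
      inside? z = P? z ×-dec Orbit? x z
      outside? : Decidable (λ z → P z × ¬ Orbit x z)
      outside? z = P? z ×-dec ¬? (Orbit? x z)
      inside≡m : card inside? ≡ m
      inside≡m = trans (≤-antisym (card-mono inside? (Orbit? x) λ _ → proj₂)
        (card-mono (Orbit? x) inside? λ { _ (i , refl) → closed-pow (toℕ i) , i , refl })) (card-orbit x)
      outside-closed : ∀ z → P z × ¬ Orbit x z → P (z · y) × ¬ Orbit x (z · y)
      outside-closed z (p , ¬o) = closed z p , λ o → ¬o (orbit-back o)
      outside≤k : card outside? ≤ k
      outside≤k = ≤-pred (begin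
        suc (card outside?)              ≤⟨ +-monoˡ-≤ (card outside?) (≤-trans 0<m (≤-reflexive (sym inside≡m))) ⟩
        card inside? + card outside?     ≡⟨ sym (card-split P? (Orbit? x)) ⟩
        card P?                          ≡⟨ eq ⟩
        suc c                            ≤⟨ ≤k ⟩
        suc k                            ∎)
        where open ≤-Reasoning

    m∣n : m ∣ n
    m∣n = subst (m ∣_) (≤-antisym (card-≤n all?) n≤) (closed⇒m∣card n all? (λ _ _ → tt) (card-≤n all?))
      where
      all? : Decidable (λ (x : Fin n) → ⊤)
      all? x = yes tt
      n≤ : n ≤ card all?
      n≤ = card-injection all? (λ x → x) (λ _ → tt) (λ _ _ eq → eq)

  pow-n : ∀ y → pw y n ≡ ε
  pow-n y with Lagrange.m∣n y
  ... | divides k n≡ = trans (cong (pw y) n≡) (trans (pow-* y k (Lagrange.m y))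
    (trans (cong (λ z → pw z k) (Lagrange.y^m≡ε y)) (pow-ε k)))

  -- Cyclic subgroups and their left cosets

  C : Fin n → Subset
  C r x = ∃ λ k → pw r k ≡ x

  C? : ∀ r → Decidable (C r)
  C? r x = map′ (λ (i , eq) → toℕ i , eq)
    (λ { (k , refl) → fromℕ< (m%n<n k n) , trans (cong (pw r) (toℕ-fromℕ< (m%n<n k n))) (sym (pow-%n k)) })
    (any? λ (i : Fin n) → pw r (toℕ i) ≟ᶠ x)
    where
    pow-%n : ∀ k → pw r k ≡ pw r (k % n)
    pow-%n k = trans (cong (pw r) (m≡m%n+[m/n]*n k n)) (trans (pow-+ r (k % n) (k / n * n))
      (trans (cong (pw r (k % n) ·_) (trans (pow-* r (k / n) n) (trans (cong (λ z → pw z (k / n)) (pow-n r)) (pow-ε (k / n)))))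
        (identityʳ _)))

  C-ε : ∀ {r} → C r ε
  C-ε = 0 , refl

  C-self : ∀ {r} → C r r
  C-self {r} = 1 , identityʳ r

  C-· : ∀ {r x y} → C r x → C r y → C r (x · y)
  C-· {r} (a , refl) (b , refl) = a + b , pow-+ r a b

  C-pow : ∀ {r x} k → C r x → C r (pw x k)
  C-pow {r} k (a , refl) = k * a , pow-* r k a

  C-trans : ∀ {r x y} → C r x → C x y → C r y
  C-trans rx (k , refl) = C-pow k rx

  C-⁻¹ : ∀ {r x} → C r x → C r (x ⁻¹)
  C-⁻¹ {r} {x} rx = subst (C r) x^[n-1]≡x⁻¹ (C-pow (n ∸ 1) rx)
    where
    x^[n-1]≡x⁻¹ : pw x (n ∸ 1) ≡ x ⁻¹
    x^[n-1]≡x⁻¹ = inverseʳ-unique x (pw x (n ∸ 1))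
      (trans (cong (pw x) (suc-pred n)) (pow-n x))

  infix 4 _≈[_]_

  -- Equality of the left cosets x⟨r⟩ and y⟨r⟩.
  _≈[_]_ : Fin n → Fin n → Fin n → Set
  x ≈[ r ] y = C r (x ⁻¹ · y)

  ≈-refl : ∀ {r} x → x ≈[ r ] x
  ≈-refl {r} x = subst (C r) (sym (inverseˡ x)) C-ε

  ≈-sym : ∀ {r x y} → x ≈[ r ] y → y ≈[ r ] x
  ≈-sym {r} {x} {y} c = subst (C r)
    (trans (⁻¹-anti-homo-∙ (x ⁻¹) y) (cong (y ⁻¹ ·_) (⁻¹-involutive x))) (C-⁻¹ c)

  ≈-trans : ∀ {r x y z} → x ≈[ r ] y → y ≈[ r ] z → x ≈[ r ] z
  ≈-trans {r} {x} {y} {z} c d = subst (C r)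
    (trans (assoc (x ⁻¹) y (y ⁻¹ · z)) (cong (x ⁻¹ ·_) (y·y⁻¹·x z y))) (C-· c d)

  ≈-·ˡ : ∀ {r x y} g → x ≈[ r ] y → g · x ≈[ r ] g · y
  ≈-·ˡ {r} {x} {y} g c = subst (C r) (sym (trans (cong (_· (g · y)) (⁻¹-anti-homo-∙ g x))
    (trans (assoc (x ⁻¹) (g ⁻¹) (g · y)) (cong (x ⁻¹ ·_) (y⁻¹·y·x y g))))) c

  ≈-·ʳ : ∀ {r x c} → C r c → x ≈[ r ] x · c
  ≈-·ʳ {r} {x} {c} rc = subst (C r) (sym (y⁻¹·y·x c x)) rc

  ∃prime-divisor : ∀ d → d ≢ 1 → .{{NonZero d}} → ∃ λ q → Prime q × q ∣ d
  ∃prime-divisor d d≢1 with factorise d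
  ... | record { factors = [] ; isFactorisation = d≡1 } = contradiction d≡1 d≢1
  ... | record { factors = q ∷ qs ; isFactorisation = d≡ ; factorsPrime = q-prime ∷ _ } =
    q , q-prime , subst (q ∣_) (sym d≡) (m∣m*n _)

  -- Coset separation from the least prime divisor

  module Separation {p : ℕ} (p-least : ∀ q → Prime q → q ∣ n → p ≤ q) where

    -- A prime factor of a common divisor greater than 1 would divide n and be at most i < p.
    coprime-n : ∀ {i} → 0 < i → i < p → Coprime i n
    coprime-n {i} 0<i i<p {zero}  (0∣i , _)     = contradiction (0∣⇒≡0 0∣i) (>⇒≢ 0<i)
    coprime-n {i} 0<i i<p {suc d} (d∣i , d∣n) with suc d ≟ 1
    ... | yes d≡1 = d≡1
    ... | no d≢1 with ∃prime-divisor (suc d) d≢1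
    ...   | q , q-prime , q∣d = contradiction (p-least q q-prime (∣-trans q∣d d∣n))
      (<⇒≱ (≤-<-trans (∣⇒≤ {{>-nonZero 0<i}} (∣-trans q∣d d∣i)) i<p))

    -- As i is prime to n and yⁿ = ε, Bézout's identity makes y a power of yⁱ or the inverse of one.
    C-root : ∀ {r y i} → 0 < i → i < p → C r (pw y i) → C r y
    C-root {r} {y} {i} 0<i i<p c with coprime-Bézout (coprime-n 0<i i<p)
    ... | Bézout.Identity.+- a b eq = subst (C r) (begin
      pw (pw y i) a              ≡⟨ sym (pow-* y a i) ⟩
      pw y (a * i)               ≡⟨ cong (pw y) (sym eq) ⟩
      y · pw y (b * n)           ≡⟨ cong (y ·_) (trans (pow-* y b n) (trans (cong (λ z → pw z b) (pow-n y)) (pow-ε b))) ⟩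
      y · ε                      ≡⟨ identityʳ y ⟩
      y                          ∎) (C-pow a c)
      where open ≡-Reasoning
    ... | Bézout.Identity.-+ a b eq = subst (C r) (sym (inverseˡ-unique y (pw (pw y i) a) (begin
      y · pw (pw y i) a          ≡⟨ cong (y ·_) (sym (pow-* y a i)) ⟩
      pw y (1 + a * i)           ≡⟨ cong (pw y) eq ⟩
      pw y (b * n)               ≡⟨ trans (pow-* y b n) (trans (cong (λ z → pw z b) (pow-n y)) (pow-ε b)) ⟩
      ε                          ∎))) (C-⁻¹ (C-pow a c))
      where open ≡-Reasoning

    C-trivial : ∀ {x} → C ε x → x ≡ ε
    C-trivial (k , refl) = pow-ε k

    private
      coset-distinct-< : ∀ {r y i j x} → ¬ C r y → i < j → j < p → pw y i ≈[ r ] x → pw y j ≈[ r ] x → ⊥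
      coset-distinct-< {r} {y} {i} {j} y∉C i<j j<p yi yj = y∉C
        (C-root (m<n⇒0<n∸m i<j) (≤-<-trans (m∸n≤m j i) j<p) (subst (C r) (begin
          pw y i ⁻¹ · pw y j                       ≡⟨ cong (λ k → pw y i ⁻¹ · pw y k) (sym (m+[n∸m]≡n (<⇒≤ i<j))) ⟩
          pw y i ⁻¹ · pw y (i + (j ∸ i))           ≡⟨ cong (pw y i ⁻¹ ·_) (pow-+ y i (j ∸ i)) ⟩
          pw y i ⁻¹ · (pw y i · pw y (j ∸ i))      ≡⟨ y⁻¹·y·x _ (pw y i) ⟩
          pw y (j ∸ i)                             ∎) (≈-trans {r} {pw y i} yi (≈-sym {r} {pw y j} yj))))
        where open ≡-Reasoning

    -- If yⁱ⟨r⟩ = yʲ⟨r⟩ with i < j < p, then y^(j-i) lies in ⟨r⟩, and `C-root` puts y itself there.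
    coset-distinct : ∀ {r y i j x} → ¬ C r y → i < p → j < p → pw y i ≈[ r ] x → pw y j ≈[ r ] x → i ≡ j
    coset-distinct {r} {y} {i} {j} y∉C i<p j<p yi yj with <-cmp i j
    ... | tri< i<j _ _ = ⊥-elim (coset-distinct-< y∉C i<j j<p yi yj)
    ... | tri≈ _ i≡j _ = i≡j
    ... | tri> _ _ j<i = ⊥-elim (coset-distinct-< y∉C j<i i<p yj yi)

    pow-distinct : ∀ {r i j} → r ≢ ε → i < p → j < p → pw r i ≡ pw r j → i ≡ j
    pow-distinct {r} {i} {j} r≢ε i<p j<p eq =
      coset-distinct {ε} {r} {i} {j} (λ c → r≢ε (C-trivial c)) i<p j<p (≈-refl {ε} (pw r i))
        (subst (_≈[ ε ] pw r i) eq (≈-refl {ε} (pw r i)))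

    -- The cosets yⁱ⟨r⟩, i < p, are disjoint. A noncyclic group has such a y for every r, so all its
    -- cyclic subgroups have order at most n/p.
    p*C≤n : ∀ {r y} → ¬ C r y → p * card (C? r) ≤ n
    p*C≤n {r} {y} y∉C = ≤-trans
      (card-blocks all? (λ (i : Fin p) x → C? r (pw y (toℕ i) ⁻¹ · x))
        (λ i → ≤-reflexive (card-·ˡ (C? r) (pw y (toℕ i) ⁻¹))) (λ _ _ _ → tt)
        (λ i j x ci cj → toℕ-injective (coset-distinct y∉C (toℕ<n i) (toℕ<n j) ci cj)))
      (card-≤n all?)
      where
      all? : Decidable (λ (x : Fin n) → ⊤)
      all? x = yes tt

  exit : ∀ {Q : ℕ → Set} → (∀ k → Dec (Q k)) → Q 0 → ∀ i → ¬ Q i → ∃ λ k → k < i × Q k × ¬ Q (suc k)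
  exit Q? Q0 zero    ¬Qi = contradiction Q0 ¬Qi
  exit Q? Q0 (suc i) ¬Qi with Q? i
  ... | yes Qi  = i , ≤-refl , Qi , ¬Qi
  ... | no ¬Qi′ = let k , k<i , q = exit Q? Q0 i ¬Qi′ in k , m<n⇒m<1+n k<i , q

  -- Sets with small gains, and translates in many cosets

  module Cosets {p : ℕ} (p-least : ∀ q → Prime q → q ∣ n → p ≤ q) where
    open Separation p-least

    -- Walking along b, yb, y²b, … from p points of ⟨r⟩ leaves S at p distinct
    -- points, as the cosets yⁱ⟨r⟩ are distinct.
    walk : ∀ {S : Subset} (S? : Decidable S) {r y} → ¬ C r y → card (λ x → S? x ×-dec ¬? (S? (y · x))) < p →
      (f : Fin p → Fin n) → (∀ a b → f a ≡ f b → a ≡ b) → (∀ a → C r (f a) × S (f a)) →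
      ∀ i → i < p → ∃ λ x → pw y i ≈[ r ] x × S x
    walk {S} S? {r} {y} y∉C few f f-inj f∈ i i<p with any? (λ x → C? r (pw y i ⁻¹ · x) ×-dec S? x)
    ... | yes found = found
    ... | no none   = ⊥-elim (<⇒≱ few (card-injection leave? g (λ a → proj₂ (proj₂ (step a))) g-inj))
      where
      leave? : Decidable (λ x → S x × ¬ S (y · x))
      leave? x = S? x ×-dec ¬? (S? (y · x))
      in-coset : ∀ k a → pw y k ≈[ r ] pw y k · f a
      in-coset k a = ≈-·ʳ {r} {pw y k} (proj₁ (f∈ a))
      step : ∀ a → ∃ λ k → k < p × S (pw y k · f a) × ¬ S (y · (pw y k · f a))
      step a with exit (λ k → S? (pw y k · f a)) (subst S (sym (identityˡ _)) (proj₂ (f∈ a))) i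
                    (λ s → none (pw y i · f a , in-coset i a , s))
      ... | k , k<i , s , ¬s = k , <-trans k<i i<p , s , λ s′ → ¬s (subst S (sym (assoc y _ _)) s′)
      g : Fin p → Fin n
      g a = pw y (proj₁ (step a)) · f a
      g-inj : ∀ a b → g a ≡ g b → a ≡ b
      g-inj a b eq = f-inj a b (∙-cancelˡ (pw y (proj₁ (step a))) _ _
        (trans eq (cong (λ k → pw y k · f b) (sym k≡))))
        where
        k≡ : proj₁ (step a) ≡ proj₁ (step b)
        k≡ = coset-distinct {r} {y} y∉C (proj₁ (proj₂ (step a))) (proj₁ (proj₂ (step b)))
          (in-coset (proj₁ (step a)) a)
          (subst (pw y (proj₁ (step b)) ≈[ r ]_) (sym eq) (in-coset (proj₁ (step b)) b))

    -- If y ∉ ⟨r⟩ and neither y nor r adds p elements to B, then every coset yⁱ⟨r⟩, i < p,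
    -- is neither disjoint from B nor contained in it, and each of them yields a point of Br ∖ B.
    stuck⇒cyclic : ∀ {B : Subset} (B? : Decidable B) {r y} → r ≢ ε →
      (∀ {a} → a < p → B (pw r a)) → (∀ {a} → a < p → ¬ B (pw r (suc a) ⁻¹)) →
      card (λ x → B? x ×-dec ¬? (B? (y · x))) < p → gain B? r < p → C r y
    stuck⇒cyclic {B} B? {r} {y} r≢ε powers∈B inverses∉B few-left few-right =
      decidable-stable (C? r y) λ y∉C → <⇒≱ few-right (contra y∉C)
      where
      contra : ¬ C r y → p ≤ gain B? r
      contra y∉C = card-injection (leaves? B? r) (λ i → proj₁ (leaving i)) (λ i → proj₂ (proj₂ (leaving i)))
        (λ i j eq → toℕ-injective (coset-distinct {r} {y} y∉C (toℕ<n i) (toℕ<n j) (proj₁ (proj₂ (leaving i)))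
          (subst (pw y (toℕ j) ≈[ r ]_) (sym eq) (proj₁ (proj₂ (leaving j))))))
        where
        met : ∀ i → i < p → ∃ λ x → pw y i ≈[ r ] x × B x
        met = walk B? y∉C few-left (pw r ∘ toℕ)
          (λ a b eq → toℕ-injective (pow-distinct r≢ε (toℕ<n a) (toℕ<n b) eq))
          (λ a → (toℕ a , refl) , powers∈B (toℕ<n a))
        ¬B? : Decidable (λ x → ¬ B x)
        ¬B? x = ¬? (B? x)
        few-left′ : card (λ x → ¬B? x ×-dec ¬? (¬B? (y · x))) < p
        few-left′ = ≤-<-trans (card-mono (λ x → ¬B? x ×-dec ¬? (¬B? (y · x))) (λ x → B? (y · x) ×-dec ¬? (B? x))
            λ x (¬bx , ¬¬byx) → decidable-stable (B? (y · x)) ¬¬byx , ¬bx)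
          (≤-<-trans (≤-reflexive (sym (card-exchange B? (λ x → B? (y · x)) (card-·ˡ B? y)))) few-left)
        -- The same walk in the complement of B, from the p points r⁻¹, ..., r⁻ᵖ outside B. As many
        -- points leave the complement under y as leave B.
        missed : ∀ i → i < p → ∃ λ x → pw y i ≈[ r ] x × ¬ B x
        missed = walk ¬B? y∉C few-left′ (λ a → pw r (suc (toℕ a)) ⁻¹)
          (λ a b eq → toℕ-injective (pow-distinct r≢ε (toℕ<n a) (toℕ<n b)
            (∙-cancelˡ r _ _ (trans (sym (⁻¹-involutive _)) (trans (cong _⁻¹ eq) (⁻¹-involutive _))))))
          (λ a → C-⁻¹ (suc (toℕ a) , refl) , inverses∉B (toℕ<n a))
        -- The coset holds some x ∈ B and some x·rᵏ ∉ B, so the path x, xr, xr², ... leaves B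
        -- without leaving the coset.
        leaving : ∀ (i : Fin p) → ∃ λ x → pw y (toℕ i) ≈[ r ] x × B x × ¬ B (x · r)
        leaving i with met (toℕ i) (toℕ<n i) | missed (toℕ i) (toℕ<n i)
        ... | x , yx , bx | z , yz , ¬bz with ≈-trans {r} {x} (≈-sym {r} {pw y (toℕ i)} yx) yz
        ... | k , r^k≡ with exit (λ l → B? (x · pw r l)) (subst B (sym (identityʳ x)) bx) k
                              (λ b → ¬bz (subst B (trans (cong (x ·_) r^k≡) (y·y⁻¹·x z x)) b))
        ... | l , _ , b , ¬b = x · pw r l , ≈-trans {r} {pw y (toℕ i)} yx (≈-·ʳ {r} {x} (l , refl)) , b ,
          λ b′ → ¬b (subst B (trans (assoc x _ r) (cong (x ·_) (sym (pow-suc r l)))) b′)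

    Translates : Multiset → Subset → Subset
    Translates ν A x = ∃ λ u → Π ν u × A (u ⁻¹ · x)

    Translates? : ∀ ν {A : Subset} → Decidable A → Decidable (Translates ν A)
    Translates? ν A? x = any? λ u → Π? ν u ×-dec A? (u ⁻¹ · x)

    -- The reason is that Π ν meets at least k + 1 left cosets of ⟨r⟩. A term y is removed: either y
    -- carries a coset met by Π ν′ to a new one, which adds a translate of `A`, or the cosets met
    -- are stable under y.
    card-translates : ∀ {A : Subset} (A? : Decidable A) {r} → (∀ x → A x → C r x) →
      ∀ k ν → size ν ≡ k → k < p → (∀ g → 1 ≤ ν g → ¬ C r g) → suc k * card A? ≤ card (Translates? ν A?)
    card-translates {A} A? A⊆C zero ν size≡ k<p outside = ≤-trans (≤-reflexive (+-identityʳ (card A?)))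
      (card-mono A? (Translates? ν A?) λ x ax → ε , ε∈Π {ν} ,
        subst A (sym (trans (cong (_· x) ε⁻¹≈ε) (identityˡ x))) ax)
    card-translates {A} A? {r} A⊆C (suc k) ν size≡ k<p outside = conclude
      (any? λ u → Π? ν′ u ×-dec ¬? (any? λ v → Π? ν′ v ×-dec C? r (v ⁻¹ · (y · u))))
      where
      found = sum-pos ν (subst (1 ≤_) (sym size≡) (s≤s z≤n))
      y : Fin n
      y = proj₁ found
      ν′ : Multiset
      ν′ = ν ⊖ δ y
      δ≼ν : δ y ≼ ν
      δ≼ν = δ≼ {ν} (proj₂ found)
      ν′≼ν : ν′ ≼ ν
      ν′≼ν g = m∸n≤m (ν g) (δ y g)
      δν′≼ν : δ y ⊕ ν′ ≼ ν
      δν′≼ν g = ≤-reflexive (m+[n∸m]≡n (δ≼ν g))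
      y∉C : ¬ C r y
      y∉C = outside y (proj₂ found)
      Z? = Translates? ν A?
      Z′? = Translates? ν′ A?
      Z′⊆Z : ∀ x → Translates ν′ A x → Translates ν A x
      Z′⊆Z x (u , πu , a) = u , Π-mono ν′≼ν πu , a
      IH : suc k * card A? ≤ card Z′?
      IH = card-translates A? A⊆C k ν′
        (suc-injective (trans (trans (cong (_+ size ν′) (sym (size-δ y))) (sym (size-⊖ {ν} {δ y} δ≼ν))) size≡))
        (<-trans ≤-refl k<p) (λ g 1≤ → outside g (≤-trans 1≤ (ν′≼ν g)))
      conclude : Dec (∃ λ u → Π ν′ u × ¬ (∃ λ v → Π ν′ v × v ≈[ r ] y · u)) → suc (suc k) * card A? ≤ card Z?
      conclude (yes (u , πu , new)) = begin
        card A? + suc k * card A?        ≤⟨ +-mono-≤ (≤-reflexive (card-·ˡ A? ((y · u) ⁻¹))) IH ⟩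
        card A′? + card Z′?              ≤⟨ card-disjoint A′? Z′? Z?
            (λ x a → y · u , Π-· δν′≼ν (Π-δ y) πu , a) Z′⊆Z
            (λ x a (v , πv , a′) → new (v , πv ,
               ≈-trans {r} {v} {x} (A⊆C _ a′) (≈-sym {r} {y · u} (A⊆C _ a)))) ⟩
        card Z?                          ∎
        where
        open ≤-Reasoning
        A′? : Decidable (λ x → A ((y · u) ⁻¹ · x))
        A′? x = A? ((y · u) ⁻¹ · x)
      -- Starting from ⟨r⟩, stability under y yields all cosets yⁱ⟨r⟩. The p of them with i < p are
      -- distinct, and p ≥ k + 2.
      conclude (no closed) = ≤-trans (*-monoˡ-≤ (card A?) k<p)
        (≤-trans (card-blocks Z′? (λ (i : Fin p) x → A? (rep i ⁻¹ · x))
          (λ i → ≤-reflexive (card-·ˡ A? (rep i ⁻¹)))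
          (λ i x a → rep i , proj₁ (proj₂ (representative (toℕ i))) , a)
          (λ i j x a a′ → toℕ-injective (coset-distinct {r} {y} y∉C (toℕ<n i) (toℕ<n j) (coset i a) (coset j a′))))
          (card-mono Z′? Z? Z′⊆Z))
        where
        representative : ∀ i → ∃ λ u → Π ν′ u × u ≈[ r ] pw y i
        representative zero = ε , ε∈Π {ν′} , ≈-refl {r} ε
        representative (suc i) with representative i
        ... | u , πu , u≈ with decidable-stable (any? λ v → Π? ν′ v ×-dec C? r (v ⁻¹ · (y · u)))
                                 (λ new → closed (u , πu , new))
        ...   | v , πv , v≈ = v , πv , ≈-trans {r} {v} v≈ (≈-·ˡ {r} {u} y u≈)
        rep : Fin p → Fin n
        rep i = proj₁ (representative (toℕ i))
        coset : ∀ i {x} → A (rep i ⁻¹ · x) → pw y (toℕ i) ≈[ r ] x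
        coset i a = ≈-trans {r} {pw y (toℕ i)} (≈-sym {r} {rep i} (proj₂ (proj₂ (representative (toℕ i))))) (A⊆C _ a)

  -- Extremal choices, powers in Π, and greedy extension

  argmax : ∀ {P : Subset} (P? : Decidable P) (f : Fin n → ℕ) b → (∀ x → f x ≤ b) → ∃ P →
           ∃ λ x → P x × ∀ y → P y → f y ≤ f x
  argmax {P} P? f b f≤b (x , px) = climb b x px (m≤n+m b (f x))
    where
    climb : ∀ k x → P x → b ≤ f x + k → ∃ λ x → P x × ∀ y → P y → f y ≤ f x
    climb k x px b≤ with any? (λ y → P? y ×-dec f x <? f y)
    climb k       x px b≤ | no none = x , px , λ y py → ≮⇒≥ λ fx<fy → none (y , py , fx<fy)
    climb zero    x px b≤ | yes (y , py , fx<fy) =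
      contradiction (≤-trans (f≤b y) (≤-trans b≤ (≤-reflexive (+-identityʳ (f x))))) (<⇒≱ fx<fy)
    climb (suc k) x px b≤ | yes (y , py , fx<fy) =
      climb k y py (≤-trans b≤ (≤-trans (≤-reflexive (+-suc (f x) k)) (+-monoˡ-≤ k fx<fy)))

  card-⊆-reverse : ∀ {P Q : Subset} (P? : Decidable P) (Q? : Decidable Q) → (∀ x → P x → Q x) →
                   card Q? ≤ card P? → ∀ x → Q x → P x
  card-⊆-reverse {P} {Q} P? Q? P⊆Q Q≤P x qx = decidable-stable (P? x) λ ¬px →
    <⇒≱ (begin-strict
      card P?                    <⟨ m<m+n (card P?) (card-pos Q∖P? (qx , ¬px)) ⟩
      card P? + card Q∖P?        ≤⟨ card-disjoint P? Q∖P? Q? P⊆Q (λ _ → proj₁) (λ _ p q → proj₂ q p) ⟩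
      card Q?                    ∎) Q≤P
    where
    open ≤-Reasoning
    Q∖P? : Decidable (λ x → Q x × ¬ P x)
    Q∖P? x = Q? x ×-dec ¬? (P? x)

  Π⊆C : ∀ {μ : Multiset} {r} → (∀ g → 1 ≤ μ g → C r g) → ∀ {x} → Π μ x → C r x
  Π⊆C {μ} {r} μ⊆C (w , c , refl) = go w c
    where
    go : ∀ w → count w ≼ μ → C r (prod G w)
    go []      c = C-ε
    go (g ∷ w) c = C-· (μ⊆C g (δ≼⁻ {μ} λ x → ≤-trans (m≤m+n (δ g x) _) (c x)))
                       (go w λ x → ≤-trans (m≤n+m _ (δ g x)) (c x))

  powers : ∀ g a → ∃ λ w → prod G w ≡ pw g a × (∀ x → count w x ≡ a * δ g x)
  powers g zero    = [] , refl , λ _ → refl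
  powers g (suc a) = let w , p , c = powers g a in g ∷ w , cong (g ·_) p , λ x → cong (δ g x +_) (c x)

  count-powers : ∀ {μ : Multiset} {g} a → a ≤ μ g → ∀ x → a * δ g x ≤ μ x
  count-powers {μ} {g} a a≤μg x with x ≟ᶠ g
  ... | yes refl = ≤-trans (≤-reflexive (*-identityʳ a)) a≤μg
  ... | no _     = ≤-trans (≤-reflexive (*-zeroʳ a)) z≤n

  Π-pow : ∀ {μ : Multiset} {g} a → a ≤ μ g → Π μ (pw g a)
  Π-pow {μ} {g} a a≤μg = let w , p , c = powers g a in
    w , (λ x → ≤-trans (≤-reflexive (c x)) (count-powers {μ} a a≤μg x)) , p

  pow≢ε : ∀ {μ : Multiset} {g} → Free μ → ∀ a → suc a ≤ μ g → pw g (suc a) ≢ ε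
  pow≢ε {μ} {g} free a a<μg eq = let w , p , c = powers g a in
    free g w (λ x → ≤-trans (≤-reflexive (cong (δ g x +_) (c x))) (count-powers {μ} (suc a) a<μg x))
      (trans (cong (g ·_) p) eq)

  trim : ∀ {μ} k → k ≤ size μ → ∃ λ ν → ν ≼ μ × size ν ≡ k
  trim zero    _ = ∅ , (λ _ → z≤n) , size-∅
  trim {μ} (suc k) k<μ with trim {μ} k (<⇒≤ k<μ)
  ... | ν , ν≼μ , size≡ with sum-pos (μ ⊖ ν) (+-cancelˡ-≤ (size ν) 1 (size (μ ⊖ ν))
        (≤-trans (≤-reflexive (trans (cong (_+ 1) size≡) (+-comm k 1))) (≤-trans k<μ (≤-reflexive (size-⊖ ν≼μ)))))
  ... | g , 1≤ = ν ⊕ δ g , (λ x → ≤-trans (+-monoʳ-≤ (ν x) (δ≼ {μ ⊖ ν} 1≤ x)) (≤-reflexive (m+[n∸m]≡n (ν≼μ x)))) ,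
    trans (size-⊕ ν (δ g)) (trans (cong₂ _+_ size≡ (size-δ g)) (+-comm k 1))

  -- The base value `c` is kept apart from `∣Π A ∣` because `A` will contain unpaid terms: it is
  -- applied with A = T ⊕ U and c = p|T| + 1, so that U enlarges the product set without being
  -- charged.
  record Extension (p c : ℕ) (A W : Multiset) : Set where
    field
      V R   : Multiset
      split : ∀ g → V g + R g ≡ W g
      large : c + p * size V ≤ ∣Π A ⊕ V ∣
      stuck : ∀ g → 1 ≤ R g → ∣Π A ⊕ V ⊕ δ g ∣ < ∣Π A ⊕ V ∣ + p

  extend : ∀ p c A W → c ≤ ∣Π A ∣ → Extension p c A W
  extend p c A W c≤ = go (size W) ∅ W ≤-refl (λ _ → refl)
    (≤-trans (≤-reflexive (trans (cong (λ k → c + p * k) size-∅) (trans (cong (c +_) (*-zeroʳ p)) (+-identityʳ c))))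
      (≤-trans c≤ (∣Π∣-mono {A} {A ⊕ ∅} λ g → m≤m+n (A g) 0)))
    where
    open ≤-Reasoning
    go : ∀ k V R → size R ≤ k → (∀ g → V g + R g ≡ W g) → c + p * size V ≤ ∣Π A ⊕ V ∣ → Extension p c A W
    go k V R R≤k split large with any? (λ g → 1 ≤? R g ×-dec ∣Π A ⊕ V ∣ + p ≤? ∣Π A ⊕ V ⊕ δ g ∣)
    ... | no none = record { V = V ; R = R ; split = split ; large = large
                           ; stuck = λ g 1≤ → ≰⇒> λ big → none (g , 1≤ , big) }
    go zero V R R≤k split large | yes (g , 1≤ , _) =
      contradiction (≤-trans 1≤ (≤-trans (term≤sum R g) R≤k)) λ()
    go (suc k) V R R≤k split large | yes (g , 1≤ , big) = go k (V ⊕ δ g) (R ⊖ δ g)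
      (≤-pred (begin
        1 + size (R ⊖ δ g)            ≡⟨ cong (_+ size (R ⊖ δ g)) (sym (size-δ g)) ⟩
        size (δ g) + size (R ⊖ δ g)   ≡⟨ sym (size-⊖ {R} {δ g} δ≼R) ⟩
        size R                        ≤⟨ R≤k ⟩
        suc k                         ∎))
      (λ x → trans (+-assoc (V x) (δ g x) _) (trans (cong (V x +_) (m+[n∸m]≡n (δ≼R x))) (split x)))
      (begin
        c + p * size (V ⊕ δ g)        ≡⟨ cong (λ k → c + p * k) (trans (size-⊕ V (δ g)) (cong (size V +_) (size-δ g))) ⟩
        c + p * (size V + 1)          ≡⟨ arith c p (size V) ⟩
        c + p * size V + p            ≤⟨ +-monoˡ-≤ p large ⟩
        ∣Π A ⊕ V ∣ + p                ≤⟨ big ⟩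
        ∣Π A ⊕ V ⊕ δ g ∣              ≤⟨ ∣Π∣-mono {A ⊕ V ⊕ δ g} {A ⊕ (V ⊕ δ g)} (λ x → ≤-reflexive (+-assoc (A x) (V x) _)) ⟩
        ∣Π A ⊕ (V ⊕ δ g) ∣            ∎)
      where
      δ≼R : δ g ≼ R
      δ≼R = δ≼ {R} 1≤
      arith : ∀ c p v → c + p * (v + 1) ≡ c + p * v + p
      arith = solve-∀

  -- The bound for free multisets

  module Bound {m q : ℕ} (1≤m : 1 ≤ m) (n≡ : n ≡ q * suc m)
               (p-least : ∀ r → Prime r → r ∣ n → suc m ≤ r)
               (noncyclic : ∀ r → ∃ λ y → ¬ C r y) where
    open Separation p-least
    open Cosets p-least
    open ≤-Reasoning

    card-C≤q : ∀ r → card (C? r) ≤ q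
    card-C≤q r = *-cancelˡ-≤ (suc m) (begin
      suc m * card (C? r)    ≤⟨ p*C≤n (proj₂ (noncyclic r)) ⟩
      n                      ≡⟨ n≡ ⟩
      q * suc m              ≡⟨ *-comm q (suc m) ⟩
      suc m * q              ∎)

    1≤q : 1 ≤ q
    1≤q = ≤-trans (card-pos (C? ε) (C-ε {ε})) (card-C≤q ε)

    cyclic-size< : ∀ {μ r} → Free μ → (∀ g → 1 ≤ μ g → C r g) → size μ < q
    cyclic-size< {μ} {r} free μ⊆C = begin-strict
      size μ          <⟨ size<∣Π∣ free ⟩
      ∣Π μ ∣          ≤⟨ card-mono (Π? μ) (C? r) (λ _ → Π⊆C {μ} μ⊆C) ⟩
      card (C? r)     ≤⟨ card-C≤q r ⟩
      q               ∎

    infix 7 _∖C_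

    _∖C_ : Multiset → Fin n → Multiset
    (X ∖C r) g = ind (¬? (C? r g)) * X g

    ∖C≼ : ∀ X r → X ∖C r ≼ X
    ∖C≼ X r g with C? r g
    ... | yes _ = z≤n
    ... | no _  = ≤-reflexive (+-identityʳ (X g))

    ∖C-outside : ∀ X r g → 1 ≤ (X ∖C r) g → ¬ C r g
    ∖C-outside X r g 1≤ c with C? r g
    ∖C-outside X r g () c | yes _
    ... | no ¬c = ¬c c

    δ≼∖C : ∀ {X : Multiset} {r g} → 1 ≤ X g → ¬ C r g → 1 ≤ (X ∖C r) g
    δ≼∖C {X} {r} {g} 1≤ ¬c with C? r g
    ... | yes c = contradiction c ¬c
    ... | no _  = ≤-trans 1≤ (≤-reflexive (sym (+-identityʳ (X g))))

    -- k disjoint pairs, such that each cyclic subgroup generated by a remaining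
    -- term misses a term of each pair.
    Reserve : Multiset → ℕ → Set
    Reserve σ k = ∃ λ X → X ≼ σ × size X ≡ k + k × (∀ r → 1 ≤ (σ ⊖ X) r → k ≤ size (X ∖C r))

    -- A pair consists of a remaining r with |⟨r⟩| maximal and a remaining x ∉ ⟨r⟩. If no such x
    -- exists, the remaining terms lie in ⟨r⟩, so there are fewer than q of them and σ is already
    -- short.
    reserve : ∀ {σ} → Free σ → ∀ k → Reserve σ k ⊎ size σ < q + (k + k)
    reserve free zero = inj₁ (∅ , (λ _ → z≤n) , size-∅ , λ _ _ → z≤n)
    reserve {σ} free (suc k) with reserve free k
    ... | inj₂ small = inj₂ (≤-trans small (+-monoʳ-≤ q (+-mono-≤ (n≤1+n k) (n≤1+n k))))
    ... | inj₁ (X , X≼σ , size≡ , outside) with any? (λ r → 1 ≤? (σ ⊖ X) r)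
    ...   | no empty = inj₂ (begin-strict
      size σ                    ≡⟨ size-⊖ X≼σ ⟩
      size X + size (σ ⊖ X)     ≡⟨ cong₂ _+_ size≡ (trans (size-cong {σ ⊖ X} {∅} λ g →
                                     n≤0⇒n≡0 (≤-pred (≰⇒> λ 1≤ → empty (g , 1≤)))) size-∅) ⟩
      k + k + 0                 ≡⟨ +-identityʳ (k + k) ⟩
      k + k                     <⟨ +-mono-≤ 1≤q (+-mono-≤ (n≤1+n k) (n≤1+n k)) ⟩
      q + (suc k + suc k)       ∎)
    ...   | yes nonempty with argmax (λ r → 1 ≤? (σ ⊖ X) r) (λ r → card (C? r)) n (λ r → card-≤n (C? r)) nonempty
    ...     | r , 1≤r , maximal with any? (λ x → 1 ≤? (σ ⊖ X) x ×-dec ¬? (C? r x))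
    ...       | no all-in = inj₂ (begin-strict
      size σ                        ≡⟨ size-⊖ X≼σ ⟩
      size X + size (σ ⊖ X)         <⟨ +-mono-≤-< (≤-reflexive size≡) (cyclic-size< {σ ⊖ X} {r}
                                         (Free-mono (λ g → m∸n≤m (σ g) (X g)) free)
                                         (λ g 1≤ → decidable-stable (C? r g) λ ¬c → all-in (g , 1≤ , ¬c))) ⟩
      k + k + q                     ≡⟨ +-comm (k + k) q ⟩
      q + (k + k)                   ≤⟨ +-monoʳ-≤ q (+-mono-≤ (n≤1+n k) (n≤1+n k)) ⟩
      q + (suc k + suc k)           ∎)
    ...       | yes (x , 1≤x , x∉C) = inj₁ (X ⊕ pair , X′≼σ , size′≡ , outside′)
      where
      pair : Multiset
      pair = δ r ⊕ δ x
      pair≼ : pair ≼ σ ⊖ X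
      pair≼ g with g ≟ᶠ r | g ≟ᶠ x
      ... | yes refl | yes refl = contradiction C-self x∉C
      ... | yes refl | no _     = 1≤r
      ... | no _     | yes refl = 1≤x
      ... | no _     | no _     = z≤n
      X′≼σ : X ⊕ pair ≼ σ
      X′≼σ g = ≤-trans (+-monoʳ-≤ (X g) (pair≼ g)) (≤-reflexive (m+[n∸m]≡n (X≼σ g)))
      size-pair : size pair ≡ 2
      size-pair = trans (size-⊕ (δ r) (δ x)) (cong₂ _+_ (size-δ r) (size-δ x))
      size′≡ : size (X ⊕ pair) ≡ suc k + suc k
      size′≡ = trans (size-⊕ X pair) (trans (cong₂ _+_ size≡ size-pair) (arith k))
        where
        arith : ∀ k → k + k + 2 ≡ suc k + suc k
        arith = solve-∀
      pair-outside : ∀ r′ → 1 ≤ (σ ⊖ X) r′ → 1 ≤ size (pair ∖C r′)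
      pair-outside r′ 1≤r′ with C? r′ r
      ... | no r∉C′ = ≤-trans (δ≼∖C {pair} {r′} (≤-trans (≤-reflexive (sym (δ-self r))) (m≤m+n (δ r r) _)) r∉C′)
                        (term≤sum (pair ∖C r′) r)
      -- Now ⟨r⟩ ⊆ ⟨r′⟩, and r′ was available when r was chosen, so maximality gives equality and x
      -- is missed.
      ... | yes r∈C′ = ≤-trans (δ≼∖C {pair} {r′} (≤-trans (≤-reflexive (sym (δ-self x))) (m≤n+m _ (δ r x))) λ x∈C′ →
                           x∉C (card-⊆-reverse (C? r) (C? r′) (λ _ → C-trans r∈C′) (maximal r′ 1≤r′) x x∈C′))
                         (term≤sum (pair ∖C r′) x)
      outside′ : ∀ r′ → 1 ≤ (σ ⊖ (X ⊕ pair)) r′ → suc k ≤ size ((X ⊕ pair) ∖C r′)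
      outside′ r′ 1≤ = begin
        suc k                                  ≡⟨ +-comm 1 k ⟩
        k + 1                                  ≤⟨ +-mono-≤ (outside r′ 1≤′) (pair-outside r′ 1≤′) ⟩
        size (X ∖C r′) + size (pair ∖C r′)     ≡⟨ sym (size-⊕ (X ∖C r′) (pair ∖C r′)) ⟩
        size (X ∖C r′ ⊕ pair ∖C r′)            ≡⟨ size-cong (λ g → sym (*-distribˡ-+ (ind (¬? (C? r′ g))) (X g) (pair g))) ⟩
        size ((X ⊕ pair) ∖C r′)                ∎
        where
        1≤′ : 1 ≤ (σ ⊖ X) r′
        1≤′ = ≤-trans 1≤ (∸-monoʳ-≤ (σ r′) (m≤m+n (X r′) (pair r′)))

    few : ℕ
    few = (9 * m + 6) * m

    few-or-dense : ∀ {μ ρ} → μ ≼ ρ → Free ρ → (∀ g → μ g ≤ m + m) → size μ ≤ few ⊎ Dense (suc m) ρ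
    few-or-dense {μ} {ρ} μ≼ρ free μ≤2m with few <? size μ
    ... | no ¬large = inj₁ (≮⇒≥ ¬large)
    ... | yes large with dense-subsequence 1≤m μ (Free-mono μ≼ρ free) μ≤2m large
    ...   | V , V≼μ , 1≤V , dense = inj₂ (V , (λ g → ≤-trans (V≼μ g) (μ≼ρ g)) , 1≤V , dense)

    module _ {σ X} (free : Free σ) (X≼σ : X ≼ σ) (size-X : size X ≡ m + m)
             (outside : ∀ r → 1 ≤ (σ ⊖ X) r → m ≤ size (X ∖C r)) where

      Goal : Set
      Goal = size σ < q + (m + m + few)

      -- The cut of ρ at m serves both cases. If some r has multiplicity at least p in R, then U
      -- holds m copies of r, so B contains 1, r, ..., rᵐ. If there is none, U ⊕ R has
      -- multiplicities at most 2m, as `dense-subsequence` demands.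
      step : ∀ T ρ → (∀ g → T g + ρ g ≡ (σ ⊖ X) g) → suc m * size T < ∣Π T ∣ → Goal ⊎ Dense (suc m) ρ
      step T ρ T+ρ≡ T-dense = by-cases (any? λ r → suc m ≤? R r)
        where
        U W A : Multiset
        U = ρ ⊓ᵐ m
        W = ρ ∸ᵐ m
        A = T ⊕ U
        U+W≡ : ∀ g → U g + W g ≡ ρ g
        U+W≡ g = trans (cong (_+ W g) (⊓-comm (ρ g) m)) (m⊓n+n∸m≡n m (ρ g))
        open Extension (extend (suc m) (suc (suc m * size T)) A W
          (≤-trans T-dense (∣Π∣-mono {T} {A} λ g → m≤m+n (T g) (U g))))
        σ≡ : ∀ g → X g + (T g + (U g + (V g + R g))) ≡ σ g
        σ≡ g = trans (cong (λ k → X g + (T g + k)) (trans (cong (U g +_) (split g)) (U+W≡ g)))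
                 (trans (cong (X g +_) (T+ρ≡ g)) (m+[n∸m]≡n (X≼σ g)))
        size-σ : size σ ≡ m + m + (size T + (size U + (size V + size R)))
        size-σ = trans (size-cong {σ} {X ⊕ (T ⊕ (U ⊕ (V ⊕ R)))} λ g → sym (σ≡ g))
          (trans (size-⊕ X _) (cong₂ _+_ size-X (trans (size-⊕ T _) (cong (size T +_)
            (trans (size-⊕ U _) (cong (size U +_) (size-⊕ V R)))))))
        R≼σ⊖X : R ≼ σ ⊖ X
        R≼σ⊖X g = ≤-trans (≤-trans (m≤n+m (R g) (V g)) (≤-reflexive (split g)))
          (≤-trans (≤-trans (m≤n+m (W g) (U g)) (≤-reflexive (U+W≡ g)))
            (≤-trans (m≤n+m (ρ g) (T g)) (≤-reflexive (T+ρ≡ g))))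
        ρ≼σ : ρ ≼ σ
        ρ≼σ g = ≤-trans (≤-trans (m≤n+m (ρ g) (T g)) (≤-reflexive (T+ρ≡ g))) (m∸n≤m (σ g) (X g))
        U+R≼ρ : U ⊕ R ≼ ρ
        U+R≼ρ g = ≤-trans (+-monoʳ-≤ (U g) (≤-trans (m≤n+m (R g) (V g)) (≤-reflexive (split g)))) (≤-reflexive (U+W≡ g))
        AVXR≼σ : A ⊕ V ⊕ (X ⊕ R) ≼ σ
        AVXR≼σ g = ≤-reflexive (trans (arith (T g) (U g) (V g) (X g) (R g)) (σ≡ g))
          where
          arith : ∀ t u v x r → t + u + v + (x + r) ≡ x + (t + (u + (v + r)))
          arith = solve-∀
        AVR≼σ : A ⊕ V ⊕ R ≼ σ
        AVR≼σ g = ≤-trans (+-monoʳ-≤ (A g + V g) (m≤n+m (R g) (X g))) (AVXR≼σ g)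
        B? : Decidable (Π (A ⊕ V))
        B? = Π? (A ⊕ V)

        module Cyclic-case {r} (many : suc m ≤ R r) where

          1≤Rr : 1 ≤ R r
          1≤Rr = ≤-trans (s≤s z≤n) many

          Ur≡m : U r ≡ m
          Ur≡m = m≥n⇒m⊓n≡n (<⇒≤ (≰⇒> λ ρr≤m → contradiction (≤-trans 1≤Wr (≤-reflexive (m≤n⇒m∸n≡0 ρr≤m))) λ()))
            where
            1≤Wr : 1 ≤ W r
            1≤Wr = ≤-trans 1≤Rr (≤-trans (m≤n+m (R r) (V r)) (≤-reflexive (split r)))

          R⊆C : ∀ y → 1 ≤ R y → C r y
          -- The powers rᵃ, a < p, come from the copies of r in U. The p copies in R keep r⁻¹, ...,
          -- r⁻ᵖ out of B: such an inverse in B, times the matching power from R, would be ε.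
          R⊆C y 1≤Ry = stuck⇒cyclic B? (Free-g≢ε {R} (Free-mono (λ g → ≤-trans (m≤n+m (R g) _) (AVR≼σ g)) free) 1≤Rr)
            (λ {a} a<p → Π-mono U≼ (Π-pow {U} a (≤-trans (≤-pred a<p) (≤-reflexive (sym Ur≡m)))))
            (λ {a} a<p b → pow≢ε {R} (Free-mono (λ g → ≤-trans (m≤n+m (R g) _) (AVR≼σ g)) free) a (≤-trans a<p many)
              (trans (sym (⁻¹-involutive _)) (trans (cong _⁻¹
                (Free-Π free AVR≼σ b (Π-pow {R} (suc a) (≤-trans a<p many)) (inverseˡ (pw r (suc a))))) ε⁻¹≈ε)))
            (+-cancelˡ-< ∣Π A ⊕ V ∣ _ _ (≤-<-trans (∣Π∣-gainˡ {A ⊕ V} {A ⊕ V ⊕ δ y} λ _ → ≤-refl) (stuck y 1≤Ry)))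
            (+-cancelˡ-< ∣Π A ⊕ V ∣ _ _ (≤-<-trans (∣Π∣-gain {A ⊕ V} {A ⊕ V ⊕ δ r} λ _ → ≤-refl) (stuck r 1≤Rr)))
            where
            U≼ : U ≼ A ⊕ V
            U≼ g = ≤-trans (m≤n+m (U g) (T g)) (m≤m+n (A g) (V g))

          XR-large : suc m * suc (size R) ≤ ∣Π X ⊕ R ∣
          -- Exactly m reserved terms outside ⟨r⟩ spread Π R over p cosets of ⟨r⟩, which gives p|Π
          -- R| ≥ p(|R| + 1) products.
          XR-large with trim {X ∖C r} m (outside r (≤-trans 1≤Rr (R≼σ⊖X r)))
          ... | ν , ν≼ , size-ν = begin
            suc m * suc (size R)              ≤⟨ *-monoʳ-≤ (suc m) (size<∣Π∣
                                                   (Free-mono (λ g → ≤-trans (m≤n+m (R g) _) (AVR≼σ g)) free)) ⟩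
            suc m * ∣Π R ∣                    ≤⟨ card-translates (Π? R) {r} (λ _ → Π⊆C {R} R⊆C) m ν size-ν ≤-refl
                                                   (λ g 1≤ → ∖C-outside X r g (≤-trans 1≤ (ν≼ g))) ⟩
            card (Translates? ν (Π? R))       ≤⟨ card-mono (Translates? ν (Π? R)) (Π? (X ⊕ R)) (λ { x (u , πu , πx) →
                                                   subst (Π (X ⊕ R)) (y·y⁻¹·x x u)
                                                     (Π-· (λ g → +-monoˡ-≤ (R g) (≤-trans (ν≼ g) (∖C≼ X r g))) πu πx) }) ⟩
            ∣Π X ⊕ R ∣                        ∎

          TVR<q : size T + size V + size R < q
          -- The 1 from the density of T offsets the 1 lost in superadditivity, and |Π R| ≥ |R| + 1
          -- leaves a spare p, which makes the bound by q strict.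
          TVR<q = *-cancelˡ-≤ (suc m) (≤-pred (begin
            suc (suc m * suc (size T + size V + size R))                             ≡⟨ arith m (size T) (size V) (size R) ⟩
            suc (suc m * size T) + suc m * size V + suc m * suc (size R)             ≤⟨ +-mono-≤ large XR-large ⟩
            ∣Π A ⊕ V ∣ + ∣Π X ⊕ R ∣                                                  ≤⟨ ∣Π∣-additive {A ⊕ V} {X ⊕ R} {σ} free AVXR≼σ ⟩
            suc ∣Π σ ∣                                                               ≤⟨ s≤s (card-≤n (Π? σ)) ⟩
            suc n                                                                    ≡⟨ cong suc (trans n≡ (*-comm q (suc m))) ⟩
            suc (suc m * q)                                                          ∎))
            where
            arith : ∀ m t v r → suc (suc m * suc (t + v + r)) ≡ suc (suc m * t) + suc m * v + suc m * suc r
            arith = solve-∀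

          conclusion : size U ≤ few → Goal
          conclusion U≤few = begin-strict
            size σ                                                     ≡⟨ size-σ ⟩
            m + m + (size T + (size U + (size V + size R)))            ≡⟨ arith m (size T) (size U) (size V) (size R) ⟩
            size T + size V + size R + (m + m + size U)                <⟨ +-mono-<-≤ TVR<q (+-monoʳ-≤ (m + m) U≤few) ⟩
            q + (m + m + few)                                          ∎
            where
            arith : ∀ m t u v r → m + m + (t + (u + (v + r))) ≡ t + v + r + (m + m + u)
            arith = solve-∀

        TV<q : size T + size V < q
        TV<q = *-cancelˡ-< (suc m) _ _ (begin-strict
          suc m * (size T + size V)                      ≡⟨ *-distribˡ-+ (suc m) (size T) (size V) ⟩
          suc m * size T + suc m * size V                <⟨ large ⟩
          ∣Π A ⊕ V ∣                                     ≤⟨ card-≤n B? ⟩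
          n                                              ≡⟨ trans n≡ (*-comm q (suc m)) ⟩
          suc m * q                                      ∎)

        by-cases : Dec (∃ λ r → suc m ≤ R r) → Goal ⊎ Dense (suc m) ρ
        by-cases (yes (r , many)) with few-or-dense {U} {ρ} (λ g → m⊓n≤m (ρ g) m) (Free-mono ρ≼σ free)
                                        (λ g → ≤-trans (m⊓n≤n (ρ g) m) (m≤m+n m m))
        ... | inj₁ U≤few = inj₁ (Cyclic-case.conclusion many U≤few)
        ... | inj₂ dense = inj₂ dense
        by-cases (no none) with few-or-dense {U ⊕ R} {ρ} U+R≼ρ (Free-mono ρ≼σ free)
                                  (λ g → +-mono-≤ (m⊓n≤n (ρ g) m) (≤-pred (≰⇒> λ many → none (g , many))))
        ... | inj₂ dense  = inj₂ dense
        ... | inj₁ UR≤few = inj₁ (begin-strict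
          size σ                                                     ≡⟨ size-σ ⟩
          m + m + (size T + (size U + (size V + size R)))            ≡⟨ arith m (size T) (size U) (size V) (size R) ⟩
          size T + size V + (m + m + (size U + size R))              <⟨ +-mono-<-≤ TV<q (+-monoʳ-≤ (m + m)
                                                                          (≤-trans (≤-reflexive (sym (size-⊕ U R))) UR≤few)) ⟩
          q + (m + m + few)                                          ∎)
          where
          arith : ∀ m t u v r → m + m + (t + (u + (v + r))) ≡ t + v + (m + m + (u + r))
          arith = solve-∀

      -- The condition |Π T| ≥ p|T| + 1 passes to disjoint unions, since |Π| - 1 is superadditive.
      -- So a dense V found by `step` is absorbed into T, and the greedy choice is made afresh from
      -- the smaller ρ.
      iterate : ∀ k T ρ → size ρ ≤ k → (∀ g → T g + ρ g ≡ (σ ⊖ X) g) → suc m * size T < ∣Π T ∣ → Goal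
      iterate k T ρ ρ≤k T+ρ≡ T-dense with step T ρ T+ρ≡ T-dense
      ... | inj₁ goal = goal
      iterate zero T ρ ρ≤k T+ρ≡ T-dense | inj₂ (V , V≼ρ , 1≤V , V-dense) =
        contradiction (≤-trans 1≤V (≤-trans (size-mono V≼ρ) ρ≤k)) λ()
      iterate (suc k) T ρ ρ≤k T+ρ≡ T-dense | inj₂ (V , V≼ρ , 1≤V , V-dense) =
        iterate k (T ⊕ V) (ρ ⊖ V)
          (≤-pred (begin
            1 + size (ρ ⊖ V)           ≤⟨ +-monoˡ-≤ (size (ρ ⊖ V)) 1≤V ⟩
            size V + size (ρ ⊖ V)      ≡⟨ sym (size-⊖ V≼ρ) ⟩
            size ρ                     ≤⟨ ρ≤k ⟩
            suc k                      ∎))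
          (λ g → trans (+-assoc (T g) (V g) _) (trans (cong (T g +_) (m+[n∸m]≡n (V≼ρ g))) (T+ρ≡ g)))
          (≤-pred (begin
            suc (suc (suc m * size (T ⊕ V)))             ≡⟨ cong (λ k → suc (suc (suc m * k))) (size-⊕ T V) ⟩
            suc (suc (suc m * (size T + size V)))        ≡⟨ arith m (size T) (size V) ⟩
            suc (suc m * size T) + suc (suc m * size V)  ≤⟨ +-mono-≤ T-dense V-dense ⟩
            ∣Π T ∣ + ∣Π V ∣                              ≤⟨ ∣Π∣-additive {T} {V} {T ⊕ V} (Free-mono TV≼σ free) (λ _ → ≤-refl) ⟩
            suc ∣Π T ⊕ V ∣                               ∎))
        where
        arith : ∀ m t v → suc (suc (suc m * (t + v))) ≡ suc (suc m * t) + suc (suc m * v)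
        arith = solve-∀
        TV≼σ : T ⊕ V ≼ σ
        TV≼σ g = ≤-trans (+-monoʳ-≤ (T g) (V≼ρ g)) (≤-trans (≤-reflexive (T+ρ≡ g)) (m∸n≤m (σ g) (X g)))

    Free⇒size< : ∀ {σ} → Free σ → size σ < q + (m + m + few)
    Free⇒size< {σ} free with reserve free m
    ... | inj₂ small = ≤-trans small (+-monoʳ-≤ q (m≤m+n (m + m) few))
    ... | inj₁ (X , X≼σ , size-X , outside) =
      iterate free X≼σ size-X outside (size (σ ⊖ X)) ∅ (σ ⊖ X) ≤-refl (λ _ → refl)
        (subst (λ k → suc m * k < ∣Π ∅ ∣) (sym size-∅) (subst (_< ∣Π ∅ ∣) (sym (*-zeroʳ (suc m))) (card-pos (Π? ∅) (ε∈Π {∅}))))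

  -- From lists to multiplicities, and the theorem

  remove : ∀ g w → 1 ≤ count w g → ∃ λ w′ → w ↭ g ∷ w′ × (∀ x → count w x ≡ δ g x + count w′ x)
  remove g (h ∷ w) 1≤ with g ≟ᶠ h
  ... | yes refl = w , ↭-refl , λ _ → refl
  ... | no _ with remove g w 1≤
  ...   | w′ , w↭ , count≡ = h ∷ w′ , ↭-trans (prep h w↭) (swap h g ↭-refl) ,
    λ x → trans (cong (δ h x +_) (count≡ x)) (x+[y+z]≡y+[x+z] (δ h x) (δ g x) (count w′ x))
    where
    x+[y+z]≡y+[x+z] : ∀ a b c → a + (b + c) ≡ b + (a + c)
    x+[y+z]≡y+[x+z] = solve-∀

  -- Run along `S` and keep an entry whenever it still occurs in `w`; an entry that does not occur
  -- is skipped without affecting the counts that matter.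
  submultiset⇒sublist : ∀ S w → count w ≼ count S → ∃ λ T → T ⊆ S × w ↭ T
  submultiset⇒sublist []      []      _ = [] , [] , ↭-refl
  submultiset⇒sublist []      (x ∷ w) c = contradiction (δ≼⁻ {∅} (λ y → ≤-trans (m≤m+n (δ x y) _) (c y))) λ()
  submultiset⇒sublist (s ∷ S) w c with 1 ≤? count w s
  ... | yes 1≤ =
    let w′ , w↭ , count≡ = remove s w 1≤
        T , T⊆S , w′↭T = submultiset⇒sublist S w′ λ x → +-cancelˡ-≤ (δ s x) _ _ (≤-trans (≤-reflexive (sym (count≡ x))) (c x))
    in s ∷ T , refl ∷ T⊆S , ↭-trans w↭ (prep s w′↭T)
  ... | no 1≰ =
    let T , T⊆S , w↭T = submultiset⇒sublist S w skip in T , s ∷ʳ T⊆S , w↭T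
    where
    skip : count w ≼ count S
    skip x with x ≟ᶠ s | c x
    ... | yes refl | _ = ≤-trans (≤-pred (≰⇒> 1≰)) z≤n
    ... | no _     | c = c

  OneProductFree⇒Free : ∀ {S} → OneProductFree G S → Free (count S)
  OneProductFree⇒Free {S} free x w c =
    let T , T⊆S , w↭T = submultiset⇒sublist S (x ∷ w) c in free T (x ∷ w) T⊆S w↭T tt

theorem1p1 : (n : ℕ) (G : FiniteGroup n) → ¬ Cyclic G
    → (p : ℕ) → Prime p → (p∣n : p ∣ n) → (∀ (q : ℕ) → Prime q → q ∣ n → p ≤ q)
    → (d : ℕ) → IsSmallDavenport G d
    → d ≤ _∣_.quotient p∣n + (9 * p * p ∸ 10 * p)
theorem1p1 n G noncyclic p p-prime p∣n p-least d ((S , S-free , ∣S∣≡d) , _) =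
  go p (nonTrivial⇒n>1 p {{prime⇒nonTrivial p-prime}}) p∣n p-least
  where
  open FreeSequences G
  missing : ∀ r → ∃ λ y → ¬ C r y
  missing r with any? (λ y → ¬? (C? r y))
  ... | yes found = found
  ... | no none   = contradiction (r , λ h → decidable-stable (C? r h) λ ¬c → none (h , ¬c)) noncyclic

  go : ∀ p → 1 < p → (p∣n : p ∣ n) → (∀ q → Prime q → q ∣ n → p ≤ q) →
       d ≤ _∣_.quotient p∣n + (9 * p * p ∸ 10 * p)
  go (suc zero) (s≤s ()) _ _
  go (suc (suc k)) _ (divides q n≡) p-least = ≤-pred (begin-strict
    d                                                       ≡⟨ sym ∣S∣≡d ⟩
    length S                                                ≡⟨ sym (size-count S) ⟩
    size (count S)                                          <⟨ Bound.Free⇒size< (s≤s z≤n) n≡ p-least missing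
                                                                 (OneProductFree⇒Free S-free) ⟩
    -- With m = k + 1 and p = k + 2, the sum 2m + (9m + 6)m is 9p² - 10p + 1. The truncated
    -- subtraction is exact because p ≥ 2 gives 10p ≤ 9p².
    q + (suc k + suc k + (9 * suc k + 6) * suc k)           ≡⟨ cong (q +_) (expand₁ k) ⟩
    q + suc (9 * k * k + 26 * k + 16)                       ≡⟨ +-suc q _ ⟩
    suc (q + (9 * k * k + 26 * k + 16))                     ≡⟨ cong (λ e → suc (q + e)) (sym (m+n∸m≡n (10 * suc (suc k)) _)) ⟩
    suc (q + (10 * suc (suc k) + (9 * k * k + 26 * k + 16) ∸ 10 * suc (suc k)))
                                                            ≡⟨ cong (λ e → suc (q + (e ∸ 10 * suc (suc k)))) (sym (expand₂ k)) ⟩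
    suc (q + (9 * suc (suc k) * suc (suc k) ∸ 10 * suc (suc k))) ∎)
    where
    open ≤-Reasoning
    expand₁ : ∀ k → suc k + suc k + (9 * suc k + 6) * suc k ≡ suc (9 * k * k + 26 * k + 16)
    expand₁ = solve-∀
    expand₂ : ∀ k → 9 * suc (suc k) * suc (suc k) ≡ 10 * suc (suc k) + (9 * k * k + 26 * k + 16)
    expand₂ = solve-∀
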